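{- Let $m,n\ge1$ be integers with $\max(m,n)>1$, let $q>0$, $a>0$, $b,c,d\ge 0$. Consider the directed grid $G_{m,n}$ with source $s=(0,0)$, sink $t=(m,n)$, total demand $q$, latency $ax+b$ on every grid edge, and an added chord $u\to v$ with latency $cx+d$. Then the Braess Ratio satisfies \[ BR\ \le\ 1+\frac{1}{\frac{m+n}{\max(m,n)-1}+2\sqrt{\frac{m+n}{\max(m,n)-1}}}\ <\ \frac43 . \]
   Context: Grid: $G_{m,n}=(V,E)$ is the directed graph with vertex set $V=\{0,\dots,m\}\times\{0,\dots,n\}$ and directed edges $(i,j)\to(i+1,j)$ for $i<m$ and $(i,j)\to(i,j+1)$ for $j<n$. Chord: an added directed edge $u\to v$ with $u,v\in V$, $u\ne v$, such that $uv$ is not an edge of the underlying undirected grid. Feasible flow (in the grid, or in the grid plus chord): a nonnegative number $f_e$ for each directed edge $e$, with flow conserved at every vertex other than $s,t$, and net outflow from $s$ and net inflow to $t$ both equal to $q$. Its cost is $C(f)=\sum_e f_e\ell_e(f_e)$, where $\ell_e$ is the latency function of $e$. User Equilibrium: a feasible flow, decomposable into flows along $s$-$t$ paths, such that every path carrying positive flow has latency (sum of $\ell_e(f_e)$ over its edges) no larger than that of any other $s$-$t$ path. By a classical theorem (Beckmann, McGuire, Winsten) these are exactly the minimizers over feasible flows of the Beckmann potential $Z(f)=\sum_e\int_0^{f_e}\ell_e(y)\,dy$; in the networks considered here the minimizer is unique. Braess Ratio: $BR=C_{\mathrm{new}}/C_{\mathrm{old}}$, where $C_{\mathrm{old}}$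 is the cost of the User Equilibrium of $G_{m,n}$ and $C_{\mathrm{new}}$ is the cost of the User Equilibrium of $G_{m,n}$ with the chord added (same $s,t,q$). -}

module Defs where

open import Algebra.Apartness.Bundles using (HeytingCommutativeRing; HeytingField)
import Algebra.Properties.Ring as RingProperties
import Algebra.Properties.Semiring.Mult as SemiringMult
open import Algebra.Bundles using (CommutativeRing)
open import Data.Empty using (⊥-elim)
open import Data.Fin.Base as Fin using (Fin; inject₁; fromℕ)
import Data.Fin.Properties as Fin
open import Data.List.Base using (List; []; _∷_; _++_; map; filter; foldr; allFin; cartesianProduct)
open import Data.List.Membership.Propositional using (_∈_)
open import Data.List.Membership.Propositional.Properties
  using (∈-map⁺; ∈-++⁺ˡ; ∈-++⁺ʳ; ∈-allFin; ∈-cartesianProduct⁺; ∈-map⁻)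
import Data.List.Membership.DecPropositional as DecMembership
open import Data.List.Relation.Unary.All using (tabulate)
open import Data.List.Relation.Unary.Any using (here; there)
open import Data.List.Relation.Unary.AllPairs using (_∷_)
open import Data.List.Relation.Unary.Unique.Propositional using (Unique)
import Data.List.Relation.Unary.Unique.Propositional.Properties as Unique
open import Data.Maybe.Base using (Maybe; just; nothing)
import Data.Maybe.Properties as Maybe
open import Data.Nat.Base as ℕ using (ℕ; zero; suc; _∸_; _⊔_)
import Data.Nat.Properties as ℕ
open import Data.Product.Base using (Σ-syntax; ∃-syntax; _×_; _,_; proj₁; proj₂)
import Data.Product.Properties as Product
open import Data.Sum.Base using (_⊎_; inj₁; inj₂; [_,_]′)
import Data.Sum.Properties as Sum
open import Function.Base using (_∘_)
open import Function.Bundles using (_⇔_; Equivalence)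
open import Level using (0ℓ) renaming (suc to lsuc; _⊔_ to _⊔ˡ_)
open import Relation.Binary.Core using (Rel)
open import Relation.Binary.Definitions using (DecidableEquality)
open import Relation.Binary.PropositionalEquality using (_≡_; _≢_; refl)
open import Relation.Binary.Structures using (IsStrictPartialOrder)
open import Relation.Nullary using (¬_)

-- The real numbers, characterised up to isomorphism as the Cauchy-complete
-- Archimedean ordered field.  The axioms are the constructive ones, so order
-- and equality are not assumed decidable; classically they describe exactly ℝ,
-- and Cauchy reals are a model without excluded middle.  The remaining facts
-- about the order (0 < 1, cotransitivity, tightness) follow from these axioms.
record RealField c ℓ₁ ℓ₂ : Set (lsuc (c ⊔ˡ ℓ₁ ⊔ˡ ℓ₂)) where
  field
    heytingField : HeytingField c ℓ₁ ℓ₂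

  open HeytingField heytingField public
    hiding (refl; sym; trans; reflexive)
  open HeytingField heytingField public
    using () renaming (refl to ≈-refl; sym to ≈-sym; trans to ≈-trans)

  commutativeRing : CommutativeRing c ℓ₁
  commutativeRing =
    HeytingCommutativeRing.commutativeRing (HeytingField.heytingCommutativeRing heytingField)

  open SemiringMult (CommutativeRing.semiring commutativeRing) public
    using () renaming (_×_ to infixr 8 _·_)

  infix 4 _<_ _≤_
  field
    _<_                  : Rel Carrier ℓ₂
    isStrictPartialOrder : IsStrictPartialOrder _≈_ _<_
    #⇔<⊎>                : ∀ {x y} → x # y ⇔ (x < y ⊎ y < x)
    +-monoˡ-<            : ∀ {x y} z → x < y → x + z < y + z
    *-pos                : ∀ {x y} → 0# < x → 0# < y → 0# < x * y
    archimedean          : ∀ x → ∃[ n ] x < n · 1#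

  _≤_ : Rel Carrier ℓ₂
  x ≤ y = ¬ (y < x)

  IsCauchy : (ℕ → Carrier) → Set (c ⊔ˡ ℓ₂)
  IsCauchy x = ∀ ε → 0# < ε → ∃[ N ] (∀ i j → N ℕ.≤ i → N ℕ.≤ j → x i < x j + ε)

  _ConvergesTo_ : (ℕ → Carrier) → Carrier → Set (c ⊔ˡ ℓ₂)
  x ConvergesTo l =
    ∀ ε → 0# < ε → ∃[ N ] (∀ i → N ℕ.≤ i → x i < l + ε × l < x i + ε)

  field
    complete : ∀ x → IsCauchy x → ∃[ l ] x ConvergesTo l

  private
    module < = IsStrictPartialOrder isStrictPartialOrder
    module R = RingProperties (CommutativeRing.ring commutativeRing)

  fromNat : ℕ → Carrier
  fromNat n = n · 1#

  neg-pos : ∀ {x} → x < 0# → 0# < - x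
  neg-pos {x} x<0 =
    <.<-respˡ-≈ (-‿inverseʳ x) (<.<-respʳ-≈ (+-identityˡ (- x)) (+-monoˡ-< (- x) x<0))

  0<1 : 0# < 1#
  0<1 = [ (λ p → p) , ⊥-elim ∘ 1≮0 ]′ (Equivalence.to #⇔<⊎> 0#1)
    where
    0#1 : 0# # 1#
    0#1 = #-sym (invertible⇒# (1# , ≈-trans (*-identityˡ _) 1-0≈1 , ≈-trans (*-identityʳ _) 1-0≈1))
      where
      1-0≈1 : 1# - 0# ≈ 1#
      1-0≈1 = ≈-trans (+-congˡ R.-0#≈0#) (+-identityʳ 1#)
    1≮0 : ¬ (1# < 0#)
    1≮0 1<0 = <.asym 1<0 (<.<-respʳ-≈ -1*-1≈1 (*-pos (neg-pos 1<0) (neg-pos 1<0)))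
      where
      -1*-1≈1 : - 1# * - 1# ≈ 1#
      -1*-1≈1 = ≈-trans (R.-1*x≈-x (- 1#)) (R.-‿involutive 1#)

  <-cotrans : ∀ {x y} → x < y → ∀ z → x < z ⊎ z < y
  <-cotrans x<y z with #-cotrans (Equivalence.from #⇔<⊎> (inj₁ x<y)) z
  ... | inj₁ x#z = [ inj₁ , (λ z<x → inj₂ (<.trans z<x x<y)) ]′ (Equivalence.to #⇔<⊎> x#z)
  ... | inj₂ z#y = [ inj₂ , (λ y<z → inj₁ (<.trans x<y y<z)) ]′ (Equivalence.to #⇔<⊎> z#y)

  +-pos-nonneg : ∀ {x y} → 0# < x → 0# ≤ y → 0# < x + y
  +-pos-nonneg {x} {y} 0<x 0≤y =
    [ ⊥-elim ∘ 0≤y , (λ p → p) ]′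
      (<-cotrans (<.<-respˡ-≈ (+-identityˡ y) (+-monoˡ-< y 0<x)) 0#)

  +-nonneg : ∀ {x y} → 0# ≤ x → 0# ≤ y → 0# ≤ x + y
  +-nonneg {x} {y} 0≤x 0≤y x+y<0 with <-cotrans x+y<0 y
  ... | inj₂ y<0   = 0≤y y<0
  ... | inj₁ x+y<y =
    0≤x (<.<-respˡ-≈ x+y-y≈x (<.<-respʳ-≈ (-‿inverseʳ y) (+-monoˡ-< (- y) x+y<y)))
    where
    x+y-y≈x : (x + y) + - y ≈ x
    x+y-y≈x = ≈-trans (+-assoc x y (- y)) (≈-trans (+-congˡ (-‿inverseʳ y)) (+-identityʳ x))

  ·-nonneg : ∀ n {x} → 0# ≤ x → 0# ≤ n · x
  ·-nonneg zero    0≤x = <.irrefl ≈-refl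
  ·-nonneg (suc n) 0≤x = +-nonneg 0≤x (·-nonneg n 0≤x)

  fromNat-pos : ∀ n → 0 ℕ.< n → 0# < fromNat n
  fromNat-pos (suc n) _ = +-pos-nonneg 0<1 (·-nonneg n (<.asym 0<1))

  inverse : ∀ x → 0# < x → ∃[ y ] y * x ≈ 1#
  inverse x 0<x with #⇒invertible (Equivalence.from #⇔<⊎> (inj₂ 0<x))
  ... | y , y*x-0≈1 , _ = y , ≈-trans (*-congˡ (≈-sym x-0≈x)) y*x-0≈1
    where
    x-0≈x : x - 0# ≈ x
    x-0≈x = ≈-trans (+-congˡ R.-0#≈0#) (+-identityʳ x)

  -- Constructively, division needs evidence that the divisor is apart from
  -- zero; every divisor used here is positive.
  infixl 7 _/_[_]
  _/_[_] : ∀ x y → 0# < y → Carrier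
  x / y [ 0<y ] = x * proj₁ (inverse y 0<y)

  inverse-pos : ∀ {x y} → 0# < x → y * x ≈ 1# → 0# < y
  inverse-pos {x} {y} 0<x y*x≈1 = [ ⊥-elim ∘ y≮0 , (λ p → p) ]′ (Equivalence.to #⇔<⊎> y#0)
    where
    y-0≈y : y - 0# ≈ y
    y-0≈y = ≈-trans (+-congˡ R.-0#≈0#) (+-identityʳ y)
    y#0 : y # 0#
    y#0 = invertible⇒#
      (x , ≈-trans (*-congˡ y-0≈y) (≈-trans (*-comm x y) y*x≈1)
         , ≈-trans (*-congʳ y-0≈y) y*x≈1)
    y≮0 : ¬ (y < 0#)
    y≮0 y<0 = <.irrefl (≈-sym (-‿inverseʳ 1#)) (+-pos-nonneg 0<1 (<.asym 0<-1))
      where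
      0<-1 : 0# < - 1#
      0<-1 = <.<-respʳ-≈
        (≈-trans (≈-sym (R.-‿distribˡ-* y x)) (-‿cong y*x≈1))
        (*-pos (neg-pos y<0) 0<x)

  /-pos : ∀ {x y} → 0# < x → (0<y : 0# < y) → 0# < x / y [ 0<y ]
  /-pos 0<x 0<y = *-pos 0<x (inverse-pos 0<y (proj₂ (inverse _ 0<y)))

  -- By completeness every positive x has exactly one such r.
  IsSqrt : Carrier → Carrier → Set (ℓ₁ ⊔ˡ ℓ₂)
  IsSqrt x r = 0# ≤ r × r * r ≈ x

  ∑ : ∀ {i} {A : Set i} → List A → (A → Carrier) → Carrier
  ∑ xs f = foldr (λ x s → f x + s) 0# xs

record FiniteDigraph : Set₁ where
  field
    Vertex Edge    : Set
    _≟ⱽ_           : DecidableEquality Vertex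
    _≟ᴱ_           : DecidableEquality Edge
    src tgt        : Edge → Vertex
    edges          : List Edge
    edges-complete : ∀ e → e ∈ edges
    edges-unique   : Unique edges

  IsWalk : Vertex → List Edge → Vertex → Set
  IsWalk u []       w = u ≡ w
  IsWalk u (e ∷ es) w = src e ≡ u × IsWalk (tgt e) es w

  record Path (u w : Vertex) : Set where
    field
      pathEdges : List Edge
      isWalk    : IsWalk u pathEdges w
      isSimple  : Unique (u ∷ map tgt pathEdges)

module Flows {c ℓ₁ ℓ₂} (ℝ : RealField c ℓ₁ ℓ₂) where
  open RealField ℝ

  record Network : Set (lsuc 0ℓ ⊔ˡ c) where
    field
      digraph : FiniteDigraph
    open FiniteDigraph digraph public
    field
      source sink : Vertex
      latency     : Edge → Carrier → Carrier

  module _ (N : Network) where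
    open Network N
    open Path
    open DecMembership _≟ᴱ_ using (_∈?_)

    inflow outflow : (Edge → Carrier) → Vertex → Carrier
    inflow  f v = ∑ (filter (λ e → tgt e ≟ⱽ v) edges) f
    outflow f v = ∑ (filter (λ e → src e ≟ⱽ v) edges) f

    record IsFeasible (q : Carrier) (f : Edge → Carrier) : Set (c ⊔ˡ ℓ₁ ⊔ˡ ℓ₂) where
      field
        nonneg        : ∀ e → 0# ≤ f e
        conservation  : ∀ v → v ≢ source → v ≢ sink → inflow f v ≈ outflow f v
        source-demand : outflow f source - inflow f source ≈ q
        sink-demand   : inflow f sink - outflow f sink ≈ q

    pathLatency : (Edge → Carrier) → Path source sink → Carrier
    pathLatency f p = ∑ (pathEdges p) (λ e → latency e (f e))

    -- A path may occur several times in pathFlows; it carries the sum of its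
    -- amounts, which is positive exactly when one of them is.
    record UserEquilibrium (q : Carrier) : Set (c ⊔ˡ ℓ₁ ⊔ˡ ℓ₂) where
      field
        flow          : Edge → Carrier
        isFeasible    : IsFeasible q flow
        pathFlows     : List (Path source sink × Carrier)
        amount-nonneg : ∀ {p x} → (p , x) ∈ pathFlows → 0# ≤ x
        decomposes    : ∀ e →
          flow e ≈ ∑ (filter (λ px → e ∈? pathEdges (proj₁ px)) pathFlows) proj₂
        shortest      : ∀ {p x} → (p , x) ∈ pathFlows → 0# < x →
          ∀ p′ → pathLatency flow p ≤ pathLatency flow p′

    cost : (Edge → Carrier) → Carrier
    cost f = ∑ edges (λ e → f e * latency e (f e))

module Grid (m n : ℕ) where

  GridVertex : Set
  GridVertex = Fin (suc m) × Fin (suc n)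

  -- inj₁ (i , j) is the edge (i,j) → (i+1,j); inj₂ (i , j) is (i,j) → (i,j+1).
  GridEdge : Set
  GridEdge = (Fin m × Fin (suc n)) ⊎ (Fin (suc m) × Fin n)

  _≟ⱽ_ : DecidableEquality GridVertex
  _≟ⱽ_ = Product.≡-dec Fin._≟_ Fin._≟_

  _≟ᴱ_ : DecidableEquality GridEdge
  _≟ᴱ_ = Sum.≡-dec (Product.≡-dec Fin._≟_ Fin._≟_) (Product.≡-dec Fin._≟_ Fin._≟_)

  gridSrc gridTgt : GridEdge → GridVertex
  gridSrc (inj₁ (i , j)) = inject₁ i , j
  gridSrc (inj₂ (i , j)) = i , inject₁ j
  gridTgt (inj₁ (i , j)) = Fin.suc i , j
  gridTgt (inj₂ (i , j)) = i , Fin.suc j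

  private
    hs : List (Fin m × Fin (suc n))
    hs = cartesianProduct (allFin m) (allFin (suc n))

    vs : List (Fin (suc m) × Fin n)
    vs = cartesianProduct (allFin (suc m)) (allFin n)

  gridEdges : List GridEdge
  gridEdges = map inj₁ hs ++ map inj₂ vs

  gridEdges-complete : ∀ e → e ∈ gridEdges
  gridEdges-complete (inj₁ (i , j)) =
    ∈-++⁺ˡ (∈-map⁺ inj₁ (∈-cartesianProduct⁺ (∈-allFin i) (∈-allFin j)))
  gridEdges-complete (inj₂ (i , j)) =
    ∈-++⁺ʳ (map inj₁ hs) (∈-map⁺ inj₂ (∈-cartesianProduct⁺ (∈-allFin i) (∈-allFin j)))

  gridEdges-unique : Unique gridEdges
  gridEdges-unique = Unique.++⁺
    (Unique.map⁺ Sum.inj₁-injective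
      (Unique.cartesianProduct⁺ (Unique.allFin⁺ m) (Unique.allFin⁺ (suc n))))
    (Unique.map⁺ Sum.inj₂-injective
      (Unique.cartesianProduct⁺ (Unique.allFin⁺ (suc m)) (Unique.allFin⁺ n)))
    disjoint
    where
    disjoint : ∀ {e} → ¬ (e ∈ map inj₁ hs × e ∈ map inj₂ vs)
    disjoint (p , q) with ∈-map⁻ inj₁ p | ∈-map⁻ inj₂ q
    ... | _ , _ , refl | _ , _ , ()

  grid : FiniteDigraph
  grid = record
    { _≟ⱽ_           = _≟ⱽ_
    ; _≟ᴱ_           = _≟ᴱ_
    ; src            = gridSrc
    ; tgt            = gridTgt
    ; edges          = gridEdges
    ; edges-complete = gridEdges-complete
    ; edges-unique   = gridEdges-unique
    }

  HasGridEdge : GridVertex → GridVertex → Set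
  HasGridEdge u v = ∃[ e ] gridSrc e ≡ u × gridTgt e ≡ v

  IsChord : GridVertex → GridVertex → Set
  IsChord u v = u ≢ v × ¬ HasGridEdge u v × ¬ HasGridEdge v u

  -- The edge `nothing` is the chord.
  gridWithChord : GridVertex → GridVertex → FiniteDigraph
  gridWithChord u v = record
    { _≟ⱽ_           = _≟ⱽ_
    ; _≟ᴱ_           = Maybe.≡-dec _≟ᴱ_
    ; src            = λ { nothing → u ; (just e) → gridSrc e }
    ; tgt            = λ { nothing → v ; (just e) → gridTgt e }
    ; edges          = nothing ∷ map just gridEdges
    ; edges-complete = λ { nothing → here refl ; (just e) → there (∈-map⁺ just (gridEdges-complete e)) }
    ; edges-unique   = tabulate (λ p → nothing∉ (∈-map⁻ just p)) ∷ Unique.map⁺ Maybe.just-injective gridEdges-unique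
    }
    where
    nothing∉ : ∀ {e : Maybe GridEdge} → ∃[ x ] x ∈ gridEdges × e ≡ just x → nothing ≢ e
    nothing∉ (_ , _ , refl) ()

module Braess {c ℓ₁ ℓ₂} (ℝ : RealField c ℓ₁ ℓ₂) (m n : ℕ) where
  open RealField ℝ
  open Flows ℝ public
  open Grid m n public

  affine : Carrier → Carrier → Carrier → Carrier
  affine α β x = α * x + β

  gridNetwork : (a b : Carrier) → Network
  gridNetwork a b = record
    { digraph = grid
    ; source  = Fin.zero , Fin.zero
    ; sink    = fromℕ m , fromℕ n
    ; latency = λ _ → affine a b
    }

  chordNetwork : (a b c d : Carrier) (u v : GridVertex) → Network
  chordNetwork a b c d u v = record
    { digraph = gridWithChord u v
    ; source  = Fin.zero , Fin.zero
    ; sink    = fromℕ m , fromℕ n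
    ; latency = λ { nothing → affine c d ; (just _) → affine a b }
    }

  module _ (1≤m : 1 ℕ.≤ m) (1<m⊔n : 1 ℕ.< m ⊔ n) where

    ρ : Carrier
    ρ = fromNat (m ℕ.+ n) / fromNat (m ⊔ n ∸ 1) [ fromNat-pos (m ⊔ n ∸ 1) (ℕ.m<n⇒0<n∸m 1<m⊔n) ]

    ρ-pos : 0# < ρ
    ρ-pos = /-pos (fromNat-pos (m ℕ.+ n) (ℕ.≤-trans 1≤m (ℕ.m≤m+n m n))) _

    bound : ∀ {√ρ} → IsSqrt ρ √ρ → Carrier
    bound {√ρ} (0≤√ρ , _) =
      1# + 1# / (ρ + 2 · √ρ) [ +-pos-nonneg ρ-pos (·-nonneg 2 0≤√ρ) ]

  4/3 : Carrier
  4/3 = fromNat 4 / fromNat 3 [ fromNat-pos 3 (ℕ.s≤s ℕ.z≤n) ]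

{-# OPTIONS --safe #-}

-- Let f be the old flow, g the grid part and x the chord part of the new flow, and
-- write E = Σf², S = Σfg, G = Σg², r = √ρ, M = m + n, K = max(m,n) − 1.  The old
-- paths survive in the new network, so C_new ≤ aS + bMq.  Comparing with the exact
-- value of C_new, and using that the chord replaces κ = (level of v) − (level of u)
-- grid edges, gives aG ≤ aS + bκx, hence aG ≤ aS + bKq when κ ≤ K, as 0 ≤ x ≤ q.  Since
-- M = ρK, Σ((1+r)f − rg)² ≥ 0 now yields (ρ+2r) C_new ≤ (ρ+2r+1) C_old.
-- If κ > K the chord points in both coordinate directions.  The old flow makes the two
-- sides of every unit square equally long, so it is the gradient of a potential ψ, and
-- ψ u ≤ ψ v gives S ≤ E, that is, C_new ≤ C_old.
module Submission where

open import Defs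
open import Data.Nat.Base as ℕ using (ℕ; suc; _⊔_; _∸_)
open import Data.Product.Base using (Σ-syntax; _×_)
import Algebra.Apartness.Properties.HeytingCommutativeRing as HeytingProperties
open import Algebra.Apartness.Bundles using (HeytingField)
open import Algebra.Bundles using (CommutativeRing)
import Algebra.Properties.Ring as RingProperties
import Algebra.Properties.Semiring.Mult as SemiringMult
import Algebra.Solver.Ring.NaturalCoefficients.Default as SemiringSolver
open import Data.Empty using (⊥-elim)
open import Data.Fin.Base as Fin using (Fin; zero; suc; inject₁; fromℕ; toℕ)
import Data.Fin.Induction as Fin
import Data.Fin.Properties as Fin
open import Data.List.Base using (List; []; _∷_; _++_; map; filter)
import Data.List.Membership.DecPropositional as DecMembership
open import Data.List.Membership.Propositional using (_∈_)
open import Data.List.Membership.Propositional.Properties using (∈-∃++; ∈-filter⁺; ∈-filter⁻)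
open import Data.List.Membership.Propositional.Properties.WithK using (unique∧set⇒bag)
import Data.List.Properties as List
open import Data.List.Relation.Binary.BagAndSetEquality using (∼bag⇒↭)
open import Data.List.Relation.Binary.Permutation.Propositional as Perm using (_↭_)
open import Data.List.Relation.Binary.Permutation.Propositional.Properties using (shift; ∈-resp-↭)
open import Data.List.Relation.Binary.Subset.Propositional using (_⊆_)
open import Data.List.Relation.Unary.All as All using (All; []; _∷_)
open import Data.List.Relation.Unary.AllPairs using ([]; _∷_)
open import Data.List.Relation.Unary.Any using (here; there)
open import Data.List.Relation.Unary.Unique.Propositional using (Unique)
import Data.List.Relation.Unary.Unique.Propositional.Properties as Unique
open import Data.Maybe.Base using (Maybe; just; nothing)
import Data.Nat.Properties as ℕ
open import Data.Product.Base using (∃-syntax; _,_; proj₁; proj₂)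
open import Data.Sum.Base using (inj₁; inj₂; [_,_]′)
open import Function.Base using (_∘_; id)
open import Function.Bundles using (Equivalence; mk⇔)
open import Level using (Level)
open import Relation.Binary.PropositionalEquality as ≡ using (_≡_; _≢_; refl)
import Relation.Binary.Reasoning.Base.Triple as Triple
open import Relation.Binary.Structures using (IsStrictPartialOrder; IsPreorder)
open import Relation.Nullary using (¬_; Dec; yes; no)
open import Relation.Unary using (Pred; Decidable)

-- Order, apartness and finite sums over the reals.

module OrderedField {c ℓ₁ ℓ₂} (ℝ : RealField c ℓ₁ ℓ₂) where
  open RealField ℝ

  private
    module < = IsStrictPartialOrder isStrictPartialOrder
    module R = RingProperties (CommutativeRing.ring commutativeRing)
    module H = HeytingProperties (HeytingField.heytingCommutativeRing heytingField)

  open SemiringSolver (CommutativeRing.commutativeSemiring commutativeRing) public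
    using (solve; _:=_; _:+_; _:*_; con)

  <⇒≤ : ∀ {x y} → x < y → x ≤ y
  <⇒≤ = <.asym

  ≤-refl : ∀ {x} → x ≤ x
  ≤-refl = <.irrefl ≈-refl

  ≤-reflexive : ∀ {x y} → x ≈ y → x ≤ y
  ≤-reflexive = <.irrefl ∘ ≈-sym

  ≤-trans : ∀ {x y z} → x ≤ y → y ≤ z → x ≤ z
  ≤-trans {y = y} x≤y y≤z z<x = [ y≤z , x≤y ]′ (<-cotrans z<x y)

  <-≤-trans : ∀ {x y z} → x < y → y ≤ z → x < z
  <-≤-trans {z = z} x<y y≤z = [ id , ⊥-elim ∘ y≤z ]′ (<-cotrans x<y z)

  ≤-<-trans : ∀ {x y z} → x ≤ y → y < z → x < z
  ≤-<-trans {x = x} x≤y y<z = [ ⊥-elim ∘ x≤y , id ]′ (<-cotrans y<z x)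

  ≤-isPreorder : IsPreorder _≈_ _≤_
  ≤-isPreorder = record
    { isEquivalence = <.isEquivalence
    ; reflexive     = ≤-reflexive
    ; trans         = ≤-trans
    }

  module ≤-Reasoning =
    Triple ≤-isPreorder <.asym <.trans <.<-resp-≈ <⇒≤ <-≤-trans ≤-<-trans

  open ≤-Reasoning

  x+[y-x]≈y : ∀ x y → x + (y - x) ≈ y
  x+[y-x]≈y x y = begin-equality
    x + (y - x)   ≈⟨ solve 3 (λ x y z → x :+ (y :+ z) := y :+ (x :+ z)) ≈-refl x y (- x) ⟩
    y + (x - x)   ≈⟨ +-congˡ (-‿inverseʳ x) ⟩
    y + 0#        ≈⟨ +-identityʳ y ⟩
    y             ∎

  x+y-y≈x : ∀ x y → x + y - y ≈ x
  x+y-y≈x x y = begin-equality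
    x + y - y     ≈⟨ +-assoc x y (- y) ⟩
    x + (y - y)   ≈⟨ +-congˡ (-‿inverseʳ y) ⟩
    x + 0#        ≈⟨ +-identityʳ x ⟩
    x             ∎

  +-cancelʳ-≤ : ∀ {x y} z → x + z ≤ y + z → x ≤ y
  +-cancelʳ-≤ z x+z≤y+z = x+z≤y+z ∘ +-monoˡ-< z

  +-monoˡ-≤ : ∀ {x y} z → x ≤ y → x + z ≤ y + z
  +-monoˡ-≤ {x} {y} z x≤y y+z<x+z =
    x≤y (<.<-resp-≈ .proj₁ (x+y-y≈x x z) (<.<-resp-≈ .proj₂ (x+y-y≈x y z) (+-monoˡ-< (- z) y+z<x+z)))

  +-monoʳ-≤ : ∀ {x y} z → x ≤ y → z + x ≤ z + y
  +-monoʳ-≤ {x} {y} z x≤y = begin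
    z + x   ≈⟨ +-comm z x ⟩
    x + z   ≤⟨ +-monoˡ-≤ z x≤y ⟩
    y + z   ≈⟨ +-comm y z ⟩
    z + y   ∎

  +-monoʳ-< : ∀ {x y} z → x < y → z + x < z + y
  +-monoʳ-< {x} {y} z x<y = begin-strict
    z + x   ≈⟨ +-comm z x ⟩
    x + z   <⟨ +-monoˡ-< z x<y ⟩
    y + z   ≈⟨ +-comm y z ⟩
    z + y   ∎

  +-mono-≤ : ∀ {w x y z} → w ≤ x → y ≤ z → w + y ≤ x + z
  +-mono-≤ {x = x} {y} w≤x y≤z = ≤-trans (+-monoˡ-≤ y w≤x) (+-monoʳ-≤ x y≤z)

  x<x+y⇒0<y : ∀ {x y} → x < x + y → 0# < y
  x<x+y⇒0<y {x} {y} x<x+y = begin-strict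
    0#          ≈⟨ -‿inverseʳ x ⟨
    x - x       <⟨ +-monoˡ-< (- x) x<x+y ⟩
    x + y - x   ≈⟨ +-congʳ (+-comm x y) ⟩
    y + x - x   ≈⟨ x+y-y≈x y x ⟩
    y           ∎

  x≤x+y : ∀ x {y} → 0# ≤ y → x ≤ x + y
  x≤x+y x {y} 0≤y = begin
    x        ≈⟨ +-identityʳ x ⟨
    x + 0#   ≤⟨ +-monoʳ-≤ x 0≤y ⟩
    x + y    ∎

  0≤y-x : ∀ {x y} → x ≤ y → 0# ≤ y - x
  0≤y-x {x} {y} x≤y = begin
    0#      ≈⟨ -‿inverseʳ x ⟨
    x - x   ≤⟨ +-monoˡ-≤ (- x) x≤y ⟩
    y - x   ∎

  0<y-x : ∀ {x y} → x < y → 0# < y - x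
  0<y-x {x} {y} x<y = begin-strict
    0#      ≈⟨ -‿inverseʳ x ⟨
    x - x   <⟨ +-monoˡ-< (- x) x<y ⟩
    y - x   ∎

  antisym : ∀ {x y} → x ≤ y → y ≤ x → x ≈ y
  antisym x≤y y≤x = proj₁ (tight _ _) ([ y≤x , x≤y ]′ ∘ Equivalence.to #⇔<⊎>)

  -- An inverse `w` of `x * y` makes `w * y` an inverse of `x`. This recovers the sign of a factor
  -- without deciding the order.
  product#0⇒factor#0 : ∀ x y → x * y # 0# → x # 0#
  product#0⇒factor#0 x y xy#0 with #⇒invertible xy#0
  ... | w , w*xy≈1 , _ = H.invertibleˡ⇒# (w * y , (begin-equality
    w * y * (x - 0#)   ≈⟨ *-congˡ (H.x-0≈x x) ⟩
    w * y * x          ≈⟨ solve 3 (λ w x y → w :* y :* x := w :* (x :* y)) ≈-refl w x y ⟩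
    w * (x * y)        ≈⟨ *-congˡ (H.x-0≈x (x * y)) ⟨
    w * (x * y - 0#)   ≈⟨ w*xy≈1 ⟩
    1#                 ∎))

  -- A negative product is apart from zero, hence so are both factors; nonnegative factors apart
  -- from zero are positive, a contradiction.
  *-nonneg : ∀ {x y} → 0# ≤ x → 0# ≤ y → 0# ≤ x * y
  *-nonneg {x} {y} 0≤x 0≤y xy<0 = <.asym xy<0 (*-pos
    (positive 0≤x (product#0⇒factor#0 x y xy#0))
    (positive 0≤y (product#0⇒factor#0 y x (H.#-congʳ (*-comm x y) xy#0))))
    where
    xy#0 = Equivalence.from #⇔<⊎> (inj₁ xy<0)
    positive : ∀ {z} → 0# ≤ z → z # 0# → 0# < z
    positive 0≤z = [ ⊥-elim ∘ 0≤z , id ]′ ∘ Equivalence.to #⇔<⊎>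

  square-nonneg : ∀ x → 0# ≤ x * x
  square-nonneg x xx<0
    with Equivalence.to #⇔<⊎> (product#0⇒factor#0 x x (Equivalence.from #⇔<⊎> (inj₁ xx<0)))
  ... | inj₂ 0<x = <.asym xx<0 (*-pos 0<x 0<x)
  ... | inj₁ x<0 = <.asym xx<0 (begin-strict
    0#            <⟨ *-pos (neg-pos x<0) (neg-pos x<0) ⟩
    - x * - x     ≈⟨ R.-‿distribˡ-* x (- x) ⟨
    - (x * - x)   ≈⟨ -‿cong (R.-‿distribʳ-* x x) ⟨
    - - (x * x)   ≈⟨ R.-‿involutive (x * x) ⟩
    x * x         ∎)

  -- This is (x - y)² ≥ 0; writing `x` as `y + d` makes the expansion a subtraction-free semiring
  -- identity.
  2xy≤x²+y² : ∀ x y → x * y + x * y ≤ x * x + y * y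
  2xy≤x²+y² x y = begin
    x * y + x * y                   ≈⟨ +-cong xy≈ xy≈ ⟩
    (y + d) * y + (y + d) * y       ≤⟨ x≤x+y _ (square-nonneg d) ⟩
    (y + d) * y + (y + d) * y + d * d
      ≈⟨ solve 2 (λ y d → (y :+ d) :* y :+ (y :+ d) :* y :+ d :* d
                       := (y :+ d) :* (y :+ d) :+ y :* y) ≈-refl y d ⟩
    (y + d) * (y + d) + y * y       ≈⟨ +-congʳ (*-cong (x+[y-x]≈y y x) (x+[y-x]≈y y x)) ⟩
    x * x + y * y                   ∎
    where
    d = x - y
    xy≈ : x * y ≈ (y + d) * y
    xy≈ = *-congʳ (≈-sym (x+[y-x]≈y y x))

  *-monoˡ-≤ : ∀ {x y z} → 0# ≤ z → x ≤ y → z * x ≤ z * y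
  *-monoˡ-≤ {x} {y} {z} 0≤z x≤y = begin
    z * x                 ≤⟨ x≤x+y _ (*-nonneg 0≤z (0≤y-x x≤y)) ⟩
    z * x + z * (y - x)   ≈⟨ distribˡ z x (y - x) ⟨
    z * (x + (y - x))     ≈⟨ *-congˡ (x+[y-x]≈y x y) ⟩
    z * y                 ∎

  *-monoʳ-≤ : ∀ {x y z} → 0# ≤ z → x ≤ y → x * z ≤ y * z
  *-monoʳ-≤ {x} {y} {z} 0≤z x≤y = begin
    x * z   ≈⟨ *-comm x z ⟩
    z * x   ≤⟨ *-monoˡ-≤ 0≤z x≤y ⟩
    z * y   ≈⟨ *-comm z y ⟩
    y * z   ∎

  *-monoˡ-< : ∀ {x y z} → 0# < z → x < y → z * x < z * y
  *-monoˡ-< {x} {y} {z} 0<z x<y = begin-strict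
    z * x                 ≈⟨ +-identityʳ (z * x) ⟨
    z * x + 0#            <⟨ +-monoʳ-< (z * x) (*-pos 0<z (0<y-x x<y)) ⟩
    z * x + z * (y - x)   ≈⟨ distribˡ z x (y - x) ⟨
    z * (x + (y - x))     ≈⟨ *-congˡ (x+[y-x]≈y x y) ⟩
    z * y                 ∎

  *-cancelˡ-≤ : ∀ {x y z} → 0# < z → z * x ≤ z * y → x ≤ y
  *-cancelˡ-≤ 0<z zx≤zy = zx≤zy ∘ *-monoˡ-< 0<z

  *-cancelˡ-< : ∀ {x y z} → 0# < z → z * x < z * y → x < y
  *-cancelˡ-< {x} {y} {z} 0<z zx<zy = begin-strict
    x             ≈⟨ z⁻¹*[z*w]≈w x ⟨
    z⁻¹ * (z * x) <⟨ *-monoˡ-< (inverse-pos 0<z z⁻¹z≈1) zx<zy ⟩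
    z⁻¹ * (z * y) ≈⟨ z⁻¹*[z*w]≈w y ⟩
    y             ∎
    where
    z⁻¹ = proj₁ (inverse z 0<z)
    z⁻¹z≈1 = proj₂ (inverse z 0<z)
    z⁻¹*[z*w]≈w : ∀ w → z⁻¹ * (z * w) ≈ w
    z⁻¹*[z*w]≈w w = begin-equality
      z⁻¹ * (z * w)   ≈⟨ *-assoc z⁻¹ z w ⟨
      z⁻¹ * z * w     ≈⟨ *-congʳ z⁻¹z≈1 ⟩
      1# * w          ≈⟨ *-identityˡ w ⟩
      w               ∎

  -- Replaces a case split on `z ≈ 0` or `0 < z`. If the conclusion failed, `z` could not be
  -- positive, so `z ≈ 0` by tightness and both sides would vanish.
  *-monoˡ-≤-whenPos : ∀ {x y z} → 0# ≤ z → (0# < z → x ≤ y) → z * x ≤ z * y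
  *-monoˡ-≤-whenPos {x} {y} {z} 0≤z x≤y zy<zx = ≤-reflexive zx≈zy zy<zx
    where
    z≈0 : z ≈ 0#
    z≈0 = antisym (λ 0<z → *-monoˡ-≤ 0≤z (x≤y 0<z) zy<zx) 0≤z
    zx≈zy : z * x ≈ z * y
    zx≈zy = begin-equality
      z * x    ≈⟨ *-congʳ z≈0 ⟩
      0# * x   ≈⟨ zeroˡ x ⟩
      0#       ≈⟨ zeroˡ y ⟨
      0# * y   ≈⟨ *-congʳ z≈0 ⟨
      z * y    ∎

  [x/y]*y≈x : ∀ x {y} (0<y : 0# < y) → x / y [ 0<y ] * y ≈ x
  [x/y]*y≈x x {y} 0<y = begin-equality
    x * proj₁ (inverse y 0<y) * y     ≈⟨ *-assoc x _ y ⟩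
    x * (proj₁ (inverse y 0<y) * y)   ≈⟨ *-congˡ (proj₂ (inverse y 0<y)) ⟩
    x * 1#                            ≈⟨ *-identityʳ x ⟩
    x                                 ∎

  [_]·_ : ∀ {p} {P : Set p} → Dec P → Carrier → Carrier
  [ yes _ ]· x = x
  [ no  _ ]· x = 0#

  module _ {i : Level} {A : Set i} where

    ∑-cong : ∀ xs {f g : A → Carrier} → (∀ x → f x ≈ g x) → ∑ xs f ≈ ∑ xs g
    ∑-cong []       f≈g = ≈-refl
    ∑-cong (x ∷ xs) f≈g = +-cong (f≈g x) (∑-cong xs f≈g)

    ∑-mono : ∀ xs {f g : A → Carrier} → (∀ {x} → x ∈ xs → f x ≤ g x) → ∑ xs f ≤ ∑ xs g
    ∑-mono []       f≤g = ≤-refl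
    ∑-mono (x ∷ xs) f≤g = +-mono-≤ (f≤g (here refl)) (∑-mono xs (f≤g ∘ there))

    ∑-nonneg : ∀ xs {f : A → Carrier} → (∀ {x} → x ∈ xs → 0# ≤ f x) → 0# ≤ ∑ xs f
    ∑-nonneg []       0≤f = ≤-refl
    ∑-nonneg (x ∷ xs) 0≤f = +-nonneg (0≤f (here refl)) (∑-nonneg xs (0≤f ∘ there))

    ∑-++ : ∀ xs ys (f : A → Carrier) → ∑ (xs ++ ys) f ≈ ∑ xs f + ∑ ys f
    ∑-++ []       ys f = ≈-sym (+-identityˡ (∑ ys f))
    ∑-++ (x ∷ xs) ys f = begin-equality
      f x + ∑ (xs ++ ys) f        ≈⟨ +-congˡ (∑-++ xs ys f) ⟩
      f x + (∑ xs f + ∑ ys f)     ≈⟨ +-assoc (f x) (∑ xs f) (∑ ys f) ⟨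
      f x + ∑ xs f + ∑ ys f       ∎

    ∑-0 : ∀ (xs : List A) → ∑ xs (λ _ → 0#) ≈ 0#
    ∑-0 []       = ≈-refl
    ∑-0 (x ∷ xs) = ≈-trans (+-identityˡ _) (∑-0 xs)

    ∑-+ : ∀ xs (f g : A → Carrier) → ∑ xs (λ x → f x + g x) ≈ ∑ xs f + ∑ xs g
    ∑-+ []       f g = ≈-sym (+-identityˡ 0#)
    ∑-+ (x ∷ xs) f g = begin-equality
      f x + g x + ∑ xs (λ x → f x + g x)    ≈⟨ +-congˡ (∑-+ xs f g) ⟩
      f x + g x + (∑ xs f + ∑ xs g)
        ≈⟨ solve 4 (λ a b c d → a :+ b :+ (c :+ d) := a :+ c :+ (b :+ d)) ≈-refl
             (f x) (g x) (∑ xs f) (∑ xs g) ⟩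
      f x + ∑ xs f + (g x + ∑ xs g)         ∎

    ∑-*ˡ : ∀ xs y (f : A → Carrier) → ∑ xs (λ x → y * f x) ≈ y * ∑ xs f
    ∑-*ˡ []       y f = ≈-sym (zeroʳ y)
    ∑-*ˡ (x ∷ xs) y f = begin-equality
      y * f x + ∑ xs (λ x → y * f x)   ≈⟨ +-congˡ (∑-*ˡ xs y f) ⟩
      y * f x + y * ∑ xs f             ≈⟨ distribˡ y (f x) (∑ xs f) ⟨
      y * (f x + ∑ xs f)               ∎

    ∑-*ʳ : ∀ xs y (f : A → Carrier) → ∑ xs (λ x → f x * y) ≈ ∑ xs f * y
    ∑-*ʳ xs y f = begin-equality
      ∑ xs (λ x → f x * y)   ≈⟨ ∑-cong xs (λ x → *-comm (f x) y) ⟩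
      ∑ xs (λ x → y * f x)   ≈⟨ ∑-*ˡ xs y f ⟩
      y * ∑ xs f             ≈⟨ *-comm y (∑ xs f) ⟩
      ∑ xs f * y             ∎

    ∑-map : ∀ {j} {B : Set j} (h : A → B) xs (f : B → Carrier) → ∑ (map h xs) f ≈ ∑ xs (f ∘ h)
    ∑-map h []       f = ≈-refl
    ∑-map h (x ∷ xs) f = +-congˡ (∑-map h xs f)

    ∑-↭ : ∀ {xs ys} → xs ↭ ys → (f : A → Carrier) → ∑ xs f ≈ ∑ ys f
    ∑-↭ Perm.refl           f = ≈-refl
    ∑-↭ (Perm.prep x p)     f = +-congˡ (∑-↭ p f)
    ∑-↭ {_ ∷ _ ∷ xs} {_ ∷ _ ∷ ys} (Perm.swap x y p) f = begin-equality
      f x + (f y + ∑ xs f)   ≈⟨ +-congˡ (+-congˡ (∑-↭ p f)) ⟩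
      f x + (f y + ∑ ys f)
        ≈⟨ solve 3 (λ a b c → a :+ (b :+ c) := b :+ (a :+ c)) ≈-refl (f x) (f y) (∑ ys f) ⟩
      f y + (f x + ∑ ys f)   ∎
    ∑-↭ (Perm.trans p q)    f = ≈-trans (∑-↭ p f) (∑-↭ q f)

    -- Cotransitivity places the head `f x` between 0 and the sum: either it is positive, or the sum
    -- exceeds it and the rest is positive. This yields an explicit witness.
    ∑-pos⇒∃pos : ∀ xs (f : A → Carrier) → 0# < ∑ xs f → ∃[ x ] x ∈ xs × 0# < f x
    ∑-pos⇒∃pos []       f 0<0 = ⊥-elim (<.irrefl ≈-refl 0<0)
    ∑-pos⇒∃pos (x ∷ xs) f 0<s with <-cotrans 0<s (f x)
    ... | inj₁ 0<fx   = x , here refl , 0<fx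
    ... | inj₂ fx<fx+s with ∑-pos⇒∃pos xs f (x<x+y⇒0<y fx<fx+s)
    ...   | y , y∈xs , 0<fy = y , there y∈xs , 0<fy

    ∈⇒≤∑ : ∀ xs {f : A → Carrier} → (∀ x → 0# ≤ f x) → ∀ {x} → x ∈ xs → f x ≤ ∑ xs f
    ∈⇒≤∑ (x ∷ xs) 0≤f (here refl) = x≤x+y _ (∑-nonneg xs (λ {x} _ → 0≤f x))
    ∈⇒≤∑ (x ∷ xs) {f} 0≤f {y} (there y∈xs) = begin
      f y            ≤⟨ ∈⇒≤∑ xs 0≤f y∈xs ⟩
      ∑ xs f         ≤⟨ x≤x+y _ (0≤f x) ⟩
      ∑ xs f + f x   ≈⟨ +-comm (∑ xs f) (f x) ⟩
      f x + ∑ xs f   ∎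

    ∑-mono-⊆ : ∀ {xs ys} {f : A → Carrier} → (∀ x → 0# ≤ f x) → Unique xs → xs ⊆ ys →
      ∑ xs f ≤ ∑ ys f
    ∑-mono-⊆ {[]} {ys} 0≤f _            _  = ∑-nonneg ys (λ {x} _ → 0≤f x)
    ∑-mono-⊆ {x ∷ xs} {f = f} 0≤f (x∉xs ∷ xs!) x∷xs⊆ys with ∈-∃++ (x∷xs⊆ys (here refl))
    ... | as , bs , refl = begin
      f x + ∑ xs f           ≤⟨ +-monoʳ-≤ (f x) (∑-mono-⊆ 0≤f xs! xs⊆as++bs) ⟩
      f x + ∑ (as ++ bs) f   ≈⟨ ∑-↭ (shift x as bs) f ⟨
      ∑ (as ++ x ∷ bs) f     ∎
      where
      xs⊆as++bs : xs ⊆ as ++ bs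
      xs⊆as++bs z∈xs with ∈-resp-↭ (shift x as bs) (x∷xs⊆ys (there z∈xs))
      ... | here refl = ⊥-elim (All.lookup x∉xs z∈xs refl)
      ... | there z∈  = z∈

    module _ {p} {P : Pred A p} (P? : Decidable P) where

      ∑-filter : ∀ xs (f : A → Carrier) → ∑ (filter P? xs) f ≈ ∑ xs (λ x → [ P? x ]· f x)
      ∑-filter []       f = ≈-refl
      ∑-filter (x ∷ xs) f with P? x
      ... | yes _ = +-congˡ (∑-filter xs f)
      ... | no  _ = ≈-trans (∑-filter xs f) (≈-sym (+-identityˡ _))

      ∑-filter-≤ : ∀ xs {f : A → Carrier} → (∀ {x} → x ∈ xs → 0# ≤ f x) →
        ∑ (filter P? xs) f ≤ ∑ xs f
      ∑-filter-≤ []       0≤f = ≤-refl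
      ∑-filter-≤ (x ∷ xs) {f} 0≤f with P? x
      ... | yes _ = +-monoʳ-≤ (f x) (∑-filter-≤ xs (0≤f ∘ there))
      ... | no  _ = begin
        ∑ (filter P? xs) f   ≤⟨ ∑-filter-≤ xs (0≤f ∘ there) ⟩
        ∑ xs f               ≤⟨ x≤x+y _ (0≤f (here refl)) ⟩
        ∑ xs f + f x         ≈⟨ +-comm (∑ xs f) (f x) ⟩
        f x + ∑ xs f         ∎

-- Arithmetic of the bound and of affine latencies.

module Bounds {c ℓ₁ ℓ₂} (ℝ : RealField c ℓ₁ ℓ₂) where
  open RealField ℝ hiding (zero)
  open OrderedField ℝ
  open ≤-Reasoning

  private
    module × = SemiringMult (CommutativeRing.semiring commutativeRing)

  fromNat-+ : ∀ i j → fromNat (i ℕ.+ j) ≈ fromNat i + fromNat j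
  fromNat-+ = ×.×-homo-+ 1#

  fromNat-nonneg : ∀ i → 0# ≤ fromNat i
  fromNat-nonneg i = ·-nonneg i (<⇒≤ 0<1)

  fromNat-mono-≤ : ∀ {i j} → i ℕ.≤ j → fromNat i ≤ fromNat j
  fromNat-mono-≤ {j = j} ℕ.z≤n = fromNat-nonneg j
  fromNat-mono-≤ (ℕ.s≤s i≤j) = +-monoʳ-≤ 1# (fromNat-mono-≤ i≤j)

  fromNat-mono-< : ∀ {i j} → i ℕ.< j → fromNat i < fromNat j
  fromNat-mono-< {i} {j} i<j = begin-strict
    fromNat i         ≈⟨ +-identityˡ (fromNat i) ⟨
    0# + fromNat i    <⟨ +-monoˡ-< (fromNat i) 0<1 ⟩
    fromNat (suc i)   ≤⟨ fromNat-mono-≤ i<j ⟩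
    fromNat j         ∎

  /-≤ : ∀ {x y z} (0<y : 0# < y) → x ≤ y * z → x / y [ 0<y ] ≤ z
  /-≤ {x} {y} {z} 0<y x≤yz = *-cancelˡ-≤ 0<y (begin
    y * (x / y [ 0<y ])   ≈⟨ *-comm y _ ⟩
    x / y [ 0<y ] * y     ≈⟨ [x/y]*y≈x x 0<y ⟩
    x                     ≤⟨ x≤yz ⟩
    y * z                 ∎)

  </- : ∀ {x y z} (0<y : 0# < y) → y * z < x → z < x / y [ 0<y ]
  </- {x} {y} {z} 0<y yz<x = *-cancelˡ-< 0<y (begin-strict
    y * z                 <⟨ yz<x ⟩
    x                     ≈⟨ [x/y]*y≈x x 0<y ⟨
    x / y [ 0<y ] * y     ≈⟨ *-comm _ y ⟩
    y * (x / y [ 0<y ])   ∎)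

  *[1+1/] : ∀ {p} (0<p : 0# < p) → p * (1# + 1# / p [ 0<p ]) ≈ p + 1#
  *[1+1/] {p} 0<p = begin-equality
    p * (1# + 1# / p [ 0<p ])          ≈⟨ distribˡ p 1# _ ⟩
    p * 1# + p * (1# / p [ 0<p ])      ≈⟨ +-cong (*-identityʳ p) (*-comm p _) ⟩
    p + 1# / p [ 0<p ] * p             ≈⟨ +-congˡ ([x/y]*y≈x 1# 0<p) ⟩
    p + 1#                             ∎

  -- Since 1 + 1/p = (p + 1)/p, the ratio bound can be proved in this division-free form.
  /-≤1+1/ : ∀ {x y p} (0<y : 0# < y) (0<p : 0# < p) → x * p ≤ y * (p + 1#) →
    x / y [ 0<y ] ≤ 1# + 1# / p [ 0<p ]
  /-≤1+1/ {x} {y} {p} 0<y 0<p xp≤ = /-≤ 0<y (*-cancelˡ-≤ 0<p (begin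
    p * x                                  ≈⟨ *-comm p x ⟩
    x * p                                  ≤⟨ xp≤ ⟩
    y * (p + 1#)                           ≈⟨ *-congˡ (*[1+1/] 0<p) ⟨
    y * (p * (1# + 1# / p [ 0<p ]))
      ≈⟨ solve 3 (λ y p z → y :* (p :* z) := p :* (y :* z)) ≈-refl y p _ ⟩
    p * (y * (1# + 1# / p [ 0<p ]))        ∎))

  1+1/<4/3 : ∀ {p} (0<p : 0# < p) → fromNat 3 < p →
    1# + 1# / p [ 0<p ] < fromNat 4 / fromNat 3 [ fromNat-pos 3 (ℕ.s≤s ℕ.z≤n) ]
  1+1/<4/3 {p} 0<p 3<p = </- _ (*-cancelˡ-< 0<p (begin-strict
    p * (fromNat 3 * (1# + 1# / p [ 0<p ]))
      ≈⟨ solve 3 (λ p t z → p :* (t :* z) := t :* (p :* z)) ≈-refl p (fromNat 3) _ ⟩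
    fromNat 3 * (p * (1# + 1# / p [ 0<p ]))   ≈⟨ *-congˡ (*[1+1/] 0<p) ⟩
    fromNat 3 * (p + 1#)                      ≈⟨ distribˡ (fromNat 3) p 1# ⟩
    fromNat 3 * p + fromNat 3 * 1#            ≈⟨ +-congˡ (*-identityʳ _) ⟩
    fromNat 3 * p + fromNat 3                 <⟨ +-monoʳ-< _ 3<p ⟩
    fromNat 3 * p + p
      ≈⟨ solve 2 (λ p t → t :* p :+ p := p :* (con 1 :+ t)) ≈-refl p (fromNat 3) ⟩
    p * fromNat 4                             ∎))

  3<ρ+2√ρ : ∀ {ρ r} → 0# ≤ r → r * r ≈ ρ → 1# < ρ → fromNat 3 < ρ + 2 · r
  3<ρ+2√ρ {ρ} {r} 0≤r rr≈ρ 1<ρ = begin-strict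
    1# + 2 · 1#   <⟨ +-monoˡ-< _ 1<ρ ⟩
    ρ + 2 · 1#    ≤⟨ +-monoʳ-≤ ρ (+-mono-≤ 1≤r (+-monoˡ-≤ 0# 1≤r)) ⟩
    ρ + 2 · r     ∎
    where
    1≤r : 1# ≤ r
    1≤r r<1 = (begin
      ρ        ≈⟨ rr≈ρ ⟨
      r * r    ≤⟨ *-monoˡ-≤ 0≤r (<⇒≤ r<1) ⟩
      r * 1#   ≈⟨ *-identityʳ r ⟩
      r        ≤⟨ <⇒≤ r<1 ⟩
      1#       ∎) 1<ρ

  -- The hypothesis 2r(1+r)S ≤ (1+r)²E + r²G is Σ ((1+r)f − rg)² ≥ 0 for E = Σf²,
  -- S = Σfg, G = Σg².
  optimised-bound : ∀ {a b q r k E S G} → 0# ≤ a → 0# ≤ r →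
    a * G ≤ a * S + b * (q * k) →
    (1# + r) * r * S + (1# + r) * r * S ≤ (1# + r) * (1# + r) * E + r * r * G →
    let p = r * r + 2 · r
        β = b * (q * (r * r * k))
    in (a * S + β) * p ≤ (a * E + β) * (p + 1#)
  optimised-bound {a} {b} {q} {r} {k} {E} {S} {G} 0≤a 0≤r aG≤ quadratic =
    +-cancelʳ-≤ (r * r * (a * S)) (begin
      (a * S + β) * p + r * r * (a * S)
        ≈⟨ solve 6 (λ a b q r k S →
             (a :* S :+ b :* (q :* (r :* r :* k))) :* (r :* r :+ (r :+ (r :+ con 0)))
               :+ r :* r :* (a :* S) :=
             a :* ((con 1 :+ r) :* r :* S :+ (con 1 :+ r) :* r :* S)
               :+ b :* (q :* (r :* r :* k)) :* (r :* r :+ (r :+ (r :+ con 0))))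
             ≈-refl a b q r k S ⟩
      a * ((1# + r) * r * S + (1# + r) * r * S) + β * p
        ≤⟨ +-monoˡ-≤ _ (*-monoˡ-≤ 0≤a quadratic) ⟩
      a * ((1# + r) * (1# + r) * E + r * r * G) + β * p
        ≈⟨ solve 7 (λ a b q r k E G →
             a :* ((con 1 :+ r) :* (con 1 :+ r) :* E :+ r :* r :* G)
               :+ b :* (q :* (r :* r :* k)) :* (r :* r :+ (r :+ (r :+ con 0))) :=
             r :* r :* (a :* G)
               :+ (a :* E :* (r :* r :+ (r :+ (r :+ con 0)) :+ con 1)
               :+ b :* (q :* (r :* r :* k)) :* (r :* r :+ (r :+ (r :+ con 0)))))
             ≈-refl a b q r k E G ⟩
      r * r * (a * G) + (a * E * (p + 1#) + β * p)
        ≤⟨ +-monoˡ-≤ _ (*-monoˡ-≤ (square-nonneg r) aG≤) ⟩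
      r * r * (a * S + b * (q * k)) + (a * E * (p + 1#) + β * p)
        ≈⟨ solve 7 (λ a b q r k E S →
             r :* r :* (a :* S :+ b :* (q :* k))
               :+ (a :* E :* (r :* r :+ (r :+ (r :+ con 0)) :+ con 1)
               :+ b :* (q :* (r :* r :* k)) :* (r :* r :+ (r :+ (r :+ con 0)))) :=
             (a :* E :+ b :* (q :* (r :* r :* k))) :* (r :* r :+ (r :+ (r :+ con 0)) :+ con 1)
               :+ r :* r :* (a :* S))
             ≈-refl a b q r k E S ⟩
      (a * E + β) * (p + 1#) + r * r * (a * S)
        ∎)
    where
    p = r * r + 2 · r
    β = b * (q * (r * r * k))

  trivial-bound : ∀ {x y p} → 0# ≤ p → 0# ≤ y → x ≤ y → x * p ≤ y * (p + 1#)
  trivial-bound {x} {y} {p} 0≤p 0≤y x≤y = begin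
    x * p          ≤⟨ *-monoʳ-≤ 0≤p x≤y ⟩
    y * p          ≤⟨ x≤x+y _ 0≤y ⟩
    y * p + y      ≈⟨ +-congˡ (*-identityʳ y) ⟨
    y * p + y * 1# ≈⟨ distribˡ y p 1# ⟨
    y * (p + 1#)   ∎

  module _ {i : Level} {A : Set i} (xs : List A) (f g : A → Carrier) where

    -- With `g` equal to `f` this is a cost; with the new flow as `g` it is what the old flow would
    -- pay at the new latencies. The factor `1#` keeps the last sum in the form that
    -- `∑-flow-potential` evaluates for unit steps.
    ∑-affine : ∀ a b → ∑ xs (λ x → f x * (a * g x + b)) ≈
      a * ∑ xs (λ x → f x * g x) + b * ∑ xs (λ x → f x * 1#)
    ∑-affine a b = begin-equality
      ∑ xs (λ x → f x * (a * g x + b))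
        ≈⟨ ∑-cong xs (λ x → solve 4 (λ a b f g →
             f :* (a :* g :+ b) := a :* (f :* g) :+ b :* (f :* con 1)) ≈-refl a b (f x) (g x)) ⟩
      ∑ xs (λ x → a * (f x * g x) + b * (f x * 1#))
        ≈⟨ ∑-+ xs _ _ ⟩
      ∑ xs (λ x → a * (f x * g x)) + ∑ xs (λ x → b * (f x * 1#))
        ≈⟨ +-cong (∑-*ˡ xs a _) (∑-*ˡ xs b _) ⟩
      a * ∑ xs (λ x → f x * g x) + b * ∑ xs (λ x → f x * 1#)
        ∎

    ∑-2xy≤x²+y² : ∀ α β →
      let S = ∑ xs (λ x → f x * g x) in
      α * β * S + α * β * S ≤
      α * α * ∑ xs (λ x → f x * f x) + β * β * ∑ xs (λ x → g x * g x)
    ∑-2xy≤x²+y² α β = begin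
      α * β * S + α * β * S
        ≈⟨ +-cong (∑-*ˡ xs (α * β) _) (∑-*ˡ xs (α * β) _) ⟨
      ∑ xs (λ x → α * β * (f x * g x)) + ∑ xs (λ x → α * β * (f x * g x))
        ≈⟨ ∑-+ xs _ _ ⟨
      ∑ xs (λ x → α * β * (f x * g x) + α * β * (f x * g x))
        ≤⟨ ∑-mono xs (λ {x} _ → pointwise (f x) (g x)) ⟩
      ∑ xs (λ x → α * α * (f x * f x) + β * β * (g x * g x))
        ≈⟨ ∑-+ xs _ _ ⟩
      ∑ xs (λ x → α * α * (f x * f x)) + ∑ xs (λ x → β * β * (g x * g x))
        ≈⟨ +-cong (∑-*ˡ xs (α * α) _) (∑-*ˡ xs (β * β) _) ⟩
      α * α * ∑ xs (λ x → f x * f x) + β * β * ∑ xs (λ x → g x * g x)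
        ∎
      where
      S = ∑ xs (λ x → f x * g x)
      regroup : ∀ α β y z → α * β * (y * z) ≈ α * y * (β * z)
      regroup = solve 4 (λ α β y z → α :* β :* (y :* z) := α :* y :* (β :* z)) ≈-refl
      pointwise : ∀ y z →
        α * β * (y * z) + α * β * (y * z) ≤ α * α * (y * y) + β * β * (z * z)
      pointwise y z = begin
        α * β * (y * z) + α * β * (y * z)   ≈⟨ +-cong (regroup α β y z) (regroup α β y z) ⟩
        α * y * (β * z) + α * y * (β * z)   ≤⟨ 2xy≤x²+y² (α * y) (β * z) ⟩
        α * y * (α * y) + β * z * (β * z)   ≈⟨ +-cong (regroup α α y y) (regroup β β z z) ⟨
        α * α * (y * y) + β * β * (z * z)   ∎

-- Path decompositions and equilibria in an arbitrary network.

module Equilibrium {c ℓ₁ ℓ₂} (ℝ : RealField c ℓ₁ ℓ₂) (N : Flows.Network ℝ) where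
  open RealField ℝ
  open OrderedField ℝ
  open Flows ℝ
  open Network N
  open Path
  open DecMembership _≟ᴱ_ using (_∈?_)
  open ≤-Reasoning

  walk-++ : ∀ {u v w} es {es′} → IsWalk u es v → IsWalk v es′ w → IsWalk u (es ++ es′) w
  walk-++ []       refl       q = q
  walk-++ (e ∷ es) (refl , p) q = refl , walk-++ es p q

  walk-split : ∀ {u w} es {e es′} → IsWalk u (es ++ e ∷ es′) w →
    IsWalk u es (src e) × IsWalk (tgt e) es′ w
  walk-split []       (refl , p) = refl , p
  walk-split (e ∷ es) (refl , p) with walk-split es p
  ... | p₁ , p₂ = (refl , p₁) , p₂

  path-unique : ∀ {u w} (p : Path u w) → Unique (pathEdges p)
  path-unique p with isSimple p
  ... | _ ∷ tgts! = Unique.map⁻ tgts!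

  -- Neither list has repetitions, so equal membership makes them permutations of each other.
  filter∈-↭ : ∀ {es} → Unique es → filter (_∈? es) edges ↭ es
  filter∈-↭ {es} es! = ∼bag⇒↭ (unique∧set⇒bag (Unique.filter⁺ (_∈? es) edges-unique) es!
    (mk⇔ (proj₂ ∘ ∈-filter⁻ (_∈? es) {xs = edges})
      (λ e∈es → ∈-filter⁺ (_∈? es) (edges-complete _) e∈es)))

  -- Both sides sum `φ` over the vertices visited: each visit but the last is a departure, each but
  -- the first an arrival.
  walk-src-tgt : (φ : Vertex → Carrier) → ∀ es {u w} → IsWalk u es w →
    ∑ es (φ ∘ src) + φ w ≈ φ u + ∑ es (φ ∘ tgt)
  walk-src-tgt φ []       {u} refl = +-comm 0# (φ u)
  walk-src-tgt φ (e ∷ es) {w = w} (refl , p) = begin-equality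
    φ (src e) + ∑ es (φ ∘ src) + φ w                  ≈⟨ +-assoc _ _ _ ⟩
    φ (src e) + (∑ es (φ ∘ src) + φ w)                ≈⟨ +-congˡ (walk-src-tgt φ es p) ⟩
    φ (src e) + (φ (tgt e) + ∑ es (φ ∘ tgt))          ∎

  walk-telescope : (φ : Vertex → Carrier) (h : Edge → Carrier) →
    (∀ e → φ (src e) + h e ≈ φ (tgt e)) → ∀ es {u w} → IsWalk u es w → φ u + ∑ es h ≈ φ w
  walk-telescope φ h φ+h []       {u} refl = +-identityʳ (φ u)
  walk-telescope φ h φ+h (e ∷ es) {w = w} (refl , p) = begin-equality
    φ (src e) + (h e + ∑ es h)   ≈⟨ +-assoc _ _ _ ⟨
    φ (src e) + h e + ∑ es h     ≈⟨ +-congʳ (φ+h e) ⟩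
    φ (tgt e) + ∑ es h           ≈⟨ walk-telescope φ h φ+h es p ⟩
    φ w                          ∎

  module _ {q : Carrier} (ue : UserEquilibrium N q) where
    open UserEquilibrium ue
    open IsFeasible isFeasible

    private
      PathFlow : Set c
      PathFlow = Path source sink × Carrier

    -- Exchange of summation between edges and paths. `decomposes` counts a path once for each edge
    -- it contains, whereas the sum along the path counts occurrences; the two agree because paths
    -- are simple.
    ∑-flow-* : ∀ h → ∑ edges (λ e → flow e * h e) ≈
      ∑ pathFlows (λ px → proj₂ px * ∑ (pathEdges (proj₁ px)) h)
    ∑-flow-* h = ≈-trans (∑-cong edges (λ e → *-congʳ (decomposes e))) (go pathFlows)
      where
      through : List PathFlow → Edge → Carrier
      through pxs e = ∑ (filter (λ px → e ∈? pathEdges (proj₁ px)) pxs) proj₂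
      through-∷ : ∀ p x pxs e →
        through ((p , x) ∷ pxs) e * h e ≈ [ e ∈? pathEdges p ]· (x * h e) + through pxs e * h e
      through-∷ p x pxs e with e ∈? pathEdges p
      ... | yes _ = distribʳ (h e) x (through pxs e)
      ... | no  _ = ≈-sym (+-identityˡ _)
      go : ∀ pxs → ∑ edges (λ e → through pxs e * h e) ≈
        ∑ pxs (λ px → proj₂ px * ∑ (pathEdges (proj₁ px)) h)
      go []              = ≈-trans (∑-cong edges (zeroˡ ∘ h)) (∑-0 edges)
      go ((p , x) ∷ pxs) = begin-equality
        ∑ edges (λ e → through ((p , x) ∷ pxs) e * h e)
          ≈⟨ ∑-cong edges (through-∷ p x pxs) ⟩
        ∑ edges (λ e → [ e ∈? pathEdges p ]· (x * h e) + through pxs e * h e)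
          ≈⟨ ∑-+ edges _ _ ⟩
        ∑ edges (λ e → [ e ∈? pathEdges p ]· (x * h e)) + ∑ edges (λ e → through pxs e * h e)
          ≈⟨ +-cong (≈-sym (∑-filter (_∈? pathEdges p) edges (λ e → x * h e))) (go pxs) ⟩
        ∑ (filter (_∈? pathEdges p) edges) (λ e → x * h e) + _
          ≈⟨ +-congʳ (∑-↭ (filter∈-↭ (path-unique p)) (λ e → x * h e)) ⟩
        ∑ (pathEdges p) (λ e → x * h e) + _
          ≈⟨ +-congʳ (∑-*ˡ (pathEdges p) x h) ⟩
        x * ∑ (pathEdges p) h + _
          ∎

    private
      δ : Vertex → Vertex → Carrier
      δ v w = [ w ≟ⱽ v ]· 1#

      ∑-at : ∀ v (end : Edge → Vertex) →
        ∑ (filter (λ e → end e ≟ⱽ v) edges) flow ≈ ∑ edges (λ e → flow e * δ v (end e))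
      ∑-at v end = ≈-trans (∑-filter (λ e → end e ≟ⱽ v) edges flow) (∑-cong edges at)
        where
        at : ∀ e → [ end e ≟ⱽ v ]· flow e ≈ flow e * δ v (end e)
        at e with end e ≟ⱽ v
        ... | yes _ = ≈-sym (*-identityʳ (flow e))
        ... | no  _ = ≈-sym (zeroʳ (flow e))

    -- Each path leaves the source exactly once more than it enters it, as it starts there and ends
    -- elsewhere. Hence the net outflow at the source is the sum of the amounts.
    ∑-amounts : source ≢ sink → ∑ pathFlows proj₂ ≈ q
    ∑-amounts s≢t = begin-equality
      ∑ pathFlows proj₂
        ≈⟨ x+y-y≈x _ _ ⟨
      ∑ pathFlows proj₂ + inflow N flow source - inflow N flow source
        ≈⟨ +-congʳ outflow≈ ⟨
      outflow N flow source - inflow N flow source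
        ≈⟨ source-demand ⟩
      q ∎
      where
      δs = δ source
      δss≈1 : δs source ≈ 1#
      δss≈1 with source ≟ⱽ source
      ... | yes _   = ≈-refl
      ... | no  s≢s = ⊥-elim (s≢s refl)
      δst≈0 : δs sink ≈ 0#
      δst≈0 with sink ≟ⱽ source
      ... | yes t≡s = ⊥-elim (s≢t (≡.sym t≡s))
      ... | no  _   = ≈-refl
      leaves-once : ∀ (px : PathFlow) → let (p , x) = px in
        x * ∑ (pathEdges p) (δs ∘ src) ≈ x + x * ∑ (pathEdges p) (δs ∘ tgt)
      leaves-once (p , x) = begin-equality
        x * ∑ (pathEdges p) (δs ∘ src)
          ≈⟨ *-congˡ (+-identityʳ _) ⟨
        x * (∑ (pathEdges p) (δs ∘ src) + 0#)
          ≈⟨ *-congˡ (+-congˡ δst≈0) ⟨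
        x * (∑ (pathEdges p) (δs ∘ src) + δs sink)
          ≈⟨ *-congˡ (walk-src-tgt δs (pathEdges p) (isWalk p)) ⟩
        x * (δs source + ∑ (pathEdges p) (δs ∘ tgt))
          ≈⟨ *-congˡ (+-congʳ δss≈1) ⟩
        x * (1# + ∑ (pathEdges p) (δs ∘ tgt))
          ≈⟨ distribˡ x 1# _ ⟩
        x * 1# + x * ∑ (pathEdges p) (δs ∘ tgt)
          ≈⟨ +-congʳ (*-identityʳ x) ⟩
        x + x * ∑ (pathEdges p) (δs ∘ tgt)
          ∎
      outflow≈ : outflow N flow source ≈ ∑ pathFlows proj₂ + inflow N flow source
      outflow≈ = begin-equality
        outflow N flow source
          ≈⟨ ∑-at source src ⟩
        ∑ edges (λ e → flow e * δs (src e))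
          ≈⟨ ∑-flow-* (δs ∘ src) ⟩
        ∑ pathFlows (λ px → proj₂ px * ∑ (pathEdges (proj₁ px)) (δs ∘ src))
          ≈⟨ ∑-cong pathFlows leaves-once ⟩
        ∑ pathFlows (λ px → proj₂ px + proj₂ px * ∑ (pathEdges (proj₁ px)) (δs ∘ tgt))
          ≈⟨ ∑-+ pathFlows _ _ ⟩
        ∑ pathFlows proj₂ + _
          ≈⟨ +-congˡ (∑-flow-* (δs ∘ tgt)) ⟨
        ∑ pathFlows proj₂ + ∑ edges (λ e → flow e * δs (tgt e))
          ≈⟨ +-congˡ (∑-at source tgt) ⟨
        ∑ pathFlows proj₂ + inflow N flow source
          ∎

    -- When `h` is the increment of a potential, all paths from source to sink have the same
    -- `h`-length, so the sum depends on the flow only through its demand. Applied to levels, with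
    -- `h` constantly 1 on grid edges, and to the potential of the old flow.
    ∑-flow-potential : source ≢ sink → (φ : Vertex → Carrier) (h : Edge → Carrier) →
      (∀ e → φ (src e) + h e ≈ φ (tgt e)) → φ source ≈ 0# →
      ∑ edges (λ e → flow e * h e) ≈ q * φ sink
    ∑-flow-potential s≢t φ h φ+h φs≈0 = begin-equality
      ∑ edges (λ e → flow e * h e)
        ≈⟨ ∑-flow-* h ⟩
      ∑ pathFlows (λ px → proj₂ px * ∑ (pathEdges (proj₁ px)) h)
        ≈⟨ ∑-cong pathFlows (λ px → *-congˡ (path-sum (proj₁ px))) ⟩
      ∑ pathFlows (λ px → proj₂ px * φ sink)
        ≈⟨ ∑-*ʳ pathFlows (φ sink) proj₂ ⟩
      ∑ pathFlows proj₂ * φ sink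
        ≈⟨ *-congʳ (∑-amounts s≢t) ⟩
      q * φ sink
        ∎
      where
      path-sum : ∀ p → ∑ (pathEdges p) h ≈ φ sink
      path-sum p = begin-equality
        ∑ (pathEdges p) h              ≈⟨ +-identityˡ _ ⟨
        0# + ∑ (pathEdges p) h         ≈⟨ +-congʳ φs≈0 ⟨
        φ source + ∑ (pathEdges p) h   ≈⟨ walk-telescope φ h φ+h (pathEdges p) (isWalk p) ⟩
        φ sink                         ∎

    flow≤demand : source ≢ sink → ∀ e → flow e ≤ q
    flow≤demand s≢t e = begin
      flow e                                                              ≈⟨ decomposes e ⟩
      ∑ (filter (λ px → e ∈? pathEdges (proj₁ px)) pathFlows) proj₂
        ≤⟨ ∑-filter-≤ _ pathFlows (λ {px} → amount-nonneg) ⟩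
      ∑ pathFlows proj₂                                                   ≈⟨ ∑-amounts s≢t ⟩
      q                                                                   ∎

    used-path : ∀ e → 0# < flow e →
      ∃[ p ] e ∈ pathEdges p × (∀ p′ → pathLatency N flow p ≤ pathLatency N flow p′)
    used-path e 0<fe with ∑-pos⇒∃pos _ proj₂ (<-≤-trans 0<fe (≤-reflexive (decomposes e)))
    ... | (p , x) , px∈ , 0<x with ∈-filter⁻ (λ px → e ∈? pathEdges (proj₁ px)) {xs = pathFlows} px∈
    ...   | px∈pathFlows , e∈p = p , e∈p , shortest px∈pathFlows 0<x

    -- `Λ` is the latency of one path with positive amount. Other listed paths are no longer unless
    -- their amount vanishes, and then they contribute nothing to the cost.
    equilibrium-latency : source ≢ sink → 0# < q →
      ∃[ Λ ] cost N flow ≤ q * Λ × (∀ p → Λ ≤ pathLatency N flow p)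
    equilibrium-latency s≢t 0<q
      with ∑-pos⇒∃pos pathFlows proj₂ (<-≤-trans 0<q (≤-reflexive (≈-sym (∑-amounts s≢t))))
    ... | (p₀ , x₀) , px₀∈ , 0<x₀ = Λ , cost≤ , shortest px₀∈ 0<x₀
      where
      Λ = pathLatency N flow p₀
      cost≤ : cost N flow ≤ q * Λ
      cost≤ = begin
        cost N flow                                                ≈⟨ ∑-flow-* _ ⟩
        ∑ pathFlows (λ px → proj₂ px * pathLatency N flow (proj₁ px))
          ≤⟨ ∑-mono pathFlows (λ px∈ → *-monoˡ-≤-whenPos (amount-nonneg px∈)
               (λ 0<x → shortest px∈ 0<x p₀)) ⟩
        ∑ pathFlows (λ px → proj₂ px * Λ)                          ≈⟨ ∑-*ʳ pathFlows Λ proj₂ ⟩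
        ∑ pathFlows proj₂ * Λ                                      ≈⟨ *-congʳ (∑-amounts s≢t) ⟩
        q * Λ                                                      ∎

    -- The square argument uses conservation only as such one-sided estimates; the incoming edges
    -- then need only be covered by a list, not enumerated exactly.
    inflow≈outflow⇒≤ : ∀ {v} → v ≢ source → v ≢ sink → ∀ ins →
      (∀ e → tgt e ≡ v → e ∈ ins) → ∀ {e} → src e ≡ v → flow e ≤ ∑ ins flow
    inflow≈outflow⇒≤ {v} v≢s v≢t ins covers {e} se≡v = begin
      flow e            ≤⟨ ∈⇒≤∑ _ nonneg (∈-filter⁺ (λ e → src e ≟ⱽ v) (edges-complete e) se≡v) ⟩
      outflow N flow v  ≈⟨ conservation v v≢s v≢t ⟨
      inflow N flow v   ≤⟨ ∑-mono-⊆ nonneg (Unique.filter⁺ _ edges-unique)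
        (λ {e} e∈ → covers e (proj₂ (∈-filter⁻ (λ e → tgt e ≟ⱽ v) {xs = edges} e∈))) ⟩
      ∑ ins flow        ∎

    outflow≈inflow⇒≤ : ∀ {v} → v ≢ source → v ≢ sink → ∀ outs →
      (∀ e → src e ≡ v → e ∈ outs) → ∀ {e} → tgt e ≡ v → flow e ≤ ∑ outs flow
    outflow≈inflow⇒≤ {v} v≢s v≢t outs covers {e} te≡v = begin
      flow e            ≤⟨ ∈⇒≤∑ _ nonneg (∈-filter⁺ (λ e → tgt e ≟ⱽ v) (edges-complete e) te≡v) ⟩
      inflow N flow v   ≈⟨ conservation v v≢s v≢t ⟩
      outflow N flow v  ≤⟨ ∑-mono-⊆ nonneg (Unique.filter⁺ _ edges-unique)
        (λ {e} e∈ → covers e (proj₂ (∈-filter⁻ (λ e → src e ≟ⱽ v) {xs = edges} e∈))) ⟩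
      ∑ outs flow       ∎

-- Unit squares and the potential of a grid flow.

module GridFlow {c ℓ₁ ℓ₂} (ℝ : RealField c ℓ₁ ℓ₂) where
  open RealField ℝ hiding (zero)
  open OrderedField ℝ
  open ≤-Reasoning

  module _ {m n : ℕ}
    (H : Fin (suc m) → Fin (suc (suc n)) → Carrier)
    (V : Fin (suc (suc m)) → Fin (suc n) → Carrier)
    (0≤H : ∀ i j → 0# ≤ H i j) (0≤V : ∀ i j → 0# ≤ V i j)
    (exchange : ∀ i j → 0# < H i (inject₁ j) → 0# < V (suc i) j →
      H i (inject₁ j) + V (suc i) j ≤ V (inject₁ i) j + H i (suc j))
    (bottom : ∀ i → V (suc i) zero ≤ H i zero)
    (right : ∀ j → H (fromℕ m) (inject₁ j) ≤ V (suc (fromℕ m)) j)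
    (V-in : ∀ i j → V (suc i) (suc j) ≤ H i (suc (inject₁ j)) + V (suc i) (inject₁ j))
    (V-out : ∀ i j → V (inject₁ i) (inject₁ j) ≤ H i (suc (inject₁ j)) + V (inject₁ i) (suc j))
    (H-in : ∀ i j → H (suc i) (suc j) ≤ V (suc (inject₁ i)) j + H (inject₁ i) (suc j))
    (H-out : ∀ i j → H (inject₁ i) (inject₁ j) ≤ V (suc (inject₁ i)) j + H (suc i) (inject₁ j))
    where

    private
      drop-≤0 : ∀ {x y z} → x ≤ y + z → y ≤ 0# → x ≤ z
      drop-≤0 {x} {y} {z} x≤y+z y≤0 = begin
        x        ≤⟨ x≤y+z ⟩
        y + z    ≤⟨ +-monoˡ-≤ z y≤0 ⟩
        0# + z   ≈⟨ +-identityˡ z ⟩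
        z        ∎

    -- A violation over an unused bottom edge forces one in the square below, again
    -- over an unused edge; in the bottom row it contradicts conservation.
    H≈0⇒V≤V : ∀ i j → H i (inject₁ j) ≤ 0# → V (suc i) j ≤ V (inject₁ i) j
    H≈0⇒V≤V i = Fin.<-weakInduction _
      (λ H≤0 → ≤-trans (≤-trans (bottom i) H≤0) (0≤V (inject₁ i) zero)) step
      where
      step : ∀ j →
        (H i (inject₁ (inject₁ j)) ≤ 0# → V (suc i) (inject₁ j) ≤ V (inject₁ i) (inject₁ j)) →
        H i (suc (inject₁ j)) ≤ 0# → V (suc i) (suc j) ≤ V (inject₁ i) (suc j)
      step j ih H≤0 V<V = ih unused V′<V′
        where
        V′<V′ : V (inject₁ i) (inject₁ j) < V (suc i) (inject₁ j)
        V′<V′ = ≤-<-trans (drop-≤0 (V-out i j) H≤0) (<-≤-trans V<V (drop-≤0 (V-in i j) H≤0))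
        unused : H i (inject₁ (inject₁ j)) ≤ 0#
        unused 0<H = exchange i (inject₁ j) 0<H (≤-<-trans (0≤V _ _) V′<V′) (begin-strict
          V (inject₁ i) (inject₁ j) + H i (suc (inject₁ j))            ≤⟨ +-monoʳ-≤ _ H≤0 ⟩
          V (inject₁ i) (inject₁ j) + 0#                               <⟨ +-monoˡ-< 0# V′<V′ ⟩
          V (suc i) (inject₁ j) + 0#                                   ≤⟨ +-monoʳ-≤ _ (<⇒≤ 0<H) ⟩
          V (suc i) (inject₁ j) + H i (inject₁ (inject₁ j))            ≈⟨ +-comm _ _ ⟩
          H i (inject₁ (inject₁ j)) + V (suc i) (inject₁ j)            ∎)

    V≈0⇒H≤H : ∀ j i → V (suc i) j ≤ 0# → H i (inject₁ j) ≤ H i (suc j)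
    V≈0⇒H≤H j = Fin.>-weakInduction _
      (λ V≤0 → ≤-trans (≤-trans (right j) V≤0) (0≤H (fromℕ m) (suc j))) step
      where
      step : ∀ i →
        (V (suc (suc i)) j ≤ 0# → H (suc i) (inject₁ j) ≤ H (suc i) (suc j)) →
        V (suc (inject₁ i)) j ≤ 0# → H (inject₁ i) (inject₁ j) ≤ H (inject₁ i) (suc j)
      step i ih V≤0 H<H = ih unused H′<H′
        where
        H′<H′ : H (suc i) (suc j) < H (suc i) (inject₁ j)
        H′<H′ = ≤-<-trans (drop-≤0 (H-in i j) V≤0) (<-≤-trans H<H (drop-≤0 (H-out i j) V≤0))
        unused : V (suc (suc i)) j ≤ 0#
        unused 0<V = exchange (suc i) j (≤-<-trans (0≤H _ _) H′<H′) 0<V (begin-strict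
          V (inject₁ (suc i)) j + H (suc i) (suc j)         ≤⟨ +-monoˡ-≤ _ V≤0 ⟩
          0# + H (suc i) (suc j)                            <⟨ +-monoʳ-< 0# H′<H′ ⟩
          0# + H (suc i) (inject₁ j)                        ≤⟨ +-monoˡ-≤ _ (<⇒≤ 0<V) ⟩
          V (suc (suc i)) j + H (suc i) (inject₁ j)         ≈⟨ +-comm _ _ ⟩
          H (suc i) (inject₁ j) + V (suc (suc i)) j         ∎)

    square-≤ : ∀ i j → H i (inject₁ j) + V (suc i) j ≤ V (inject₁ i) j + H i (suc j)
    square-≤ i j violated = ¬bottom-unused bottom-unused
      where
      ¬bottom-unused : ¬ (H i (inject₁ j) ≤ 0#)
      ¬bottom-unused H≤0 = (begin
        H i (inject₁ j) + V (suc i) j        ≤⟨ +-mono-≤ H≤0 (H≈0⇒V≤V i j H≤0) ⟩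
        0# + V (inject₁ i) j                 ≤⟨ +-monoˡ-≤ _ (0≤H i (suc j)) ⟩
        H i (suc j) + V (inject₁ i) j        ≈⟨ +-comm _ _ ⟩
        V (inject₁ i) j + H i (suc j)        ∎) violated
      ¬right-unused : ¬ (V (suc i) j ≤ 0#)
      ¬right-unused V≤0 = (begin
        H i (inject₁ j) + V (suc i) j        ≤⟨ +-mono-≤ (V≈0⇒H≤H j i V≤0) V≤0 ⟩
        H i (suc j) + 0#                     ≤⟨ +-monoʳ-≤ _ (0≤V (inject₁ i) j) ⟩
        H i (suc j) + V (inject₁ i) j        ≈⟨ +-comm _ _ ⟩
        V (inject₁ i) j + H i (suc j)        ∎) violated
      bottom-unused : H i (inject₁ j) ≤ 0#
      bottom-unused 0<H = ¬right-unused (λ 0<V → exchange i j 0<H 0<V violated)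

  prefix : ∀ {n} → (Fin n → Carrier) → Fin (suc n) → Carrier
  prefix         f zero    = 0#
  prefix {suc n} f (suc i) = f zero + prefix (f ∘ suc) i

  prefix-suc : ∀ {n} (f : Fin n → Carrier) i → prefix f (inject₁ i) + f i ≈ prefix f (suc i)
  prefix-suc f zero    = +-comm 0# (f zero)
  prefix-suc f (suc i) = ≈-trans (+-assoc _ _ _) (+-congˡ (prefix-suc (f ∘ suc) i))

  monotone : ∀ {n} (f : Fin (suc n) → Carrier) → (∀ i → f (inject₁ i) ≤ f (suc i)) →
    ∀ {i j} → i Fin.≤ j → f i ≤ f j
  monotone f step {i} = Fin.<-weakInduction-startingFrom (λ j → f i ≤ f j) ≤-refl
    (λ j fi≤ → ≤-trans fi≤ (step j))

  module Potential {m n : ℕ}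
    (H : Fin m → Fin (suc n) → Carrier) (V : Fin (suc m) → Fin n → Carrier)
    (square : ∀ i j → H i (inject₁ j) + V (suc i) j ≈ V (inject₁ i) j + H i (suc j))
    where

    -- Flow summed along one particular path from the origin: the bottom row as far as column `i`,
    -- then up that column.
    ψ : Fin (suc m) × Fin (suc n) → Carrier
    ψ (i , j) = prefix (λ i → H i zero) i + prefix (V i) j

    ψ-V : ∀ i j → ψ (i , inject₁ j) + V i j ≈ ψ (i , suc j)
    ψ-V i j = ≈-trans (+-assoc _ _ _) (+-congˡ (prefix-suc (V i) j))

    -- True by construction in the bottom row; each `square` carries it one row up.
    ψ-H : ∀ i j → ψ (inject₁ i , j) + H i j ≈ ψ (suc i , j)
    ψ-H i = Fin.<-weakInduction _ base step
      where
      base : ψ (inject₁ i , zero) + H i zero ≈ ψ (suc i , zero)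
      base = ≈-trans (+-congʳ (+-identityʳ _))
        (≈-trans (prefix-suc (λ i → H i zero) i) (≈-sym (+-identityʳ _)))
      step : ∀ j → ψ (inject₁ i , inject₁ j) + H i (inject₁ j) ≈ ψ (suc i , inject₁ j) →
        ψ (inject₁ i , suc j) + H i (suc j) ≈ ψ (suc i , suc j)
      step j ih = begin-equality
        ψ (inject₁ i , suc j) + H i (suc j)
          ≈⟨ +-congʳ (ψ-V (inject₁ i) j) ⟨
        ψ (inject₁ i , inject₁ j) + V (inject₁ i) j + H i (suc j)
          ≈⟨ +-assoc _ _ _ ⟩
        ψ (inject₁ i , inject₁ j) + (V (inject₁ i) j + H i (suc j))
          ≈⟨ +-congˡ (square i j) ⟨
        ψ (inject₁ i , inject₁ j) + (H i (inject₁ j) + V (suc i) j)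
          ≈⟨ +-assoc _ _ _ ⟨
        ψ (inject₁ i , inject₁ j) + H i (inject₁ j) + V (suc i) j
          ≈⟨ +-congʳ ih ⟩
        ψ (suc i , inject₁ j) + V (suc i) j
          ≈⟨ ψ-V (suc i) j ⟩
        ψ (suc i , suc j) ∎

    ψ-mono : (∀ i j → 0# ≤ H i j) → (∀ i j → 0# ≤ V i j) →
      ∀ {i i′ j j′} → i Fin.≤ i′ → j Fin.≤ j′ → ψ (i , j) ≤ ψ (i′ , j′)
    ψ-mono 0≤H 0≤V {i} {i′} {j} {j′} i≤i′ j≤j′ = ≤-trans
      (monotone (λ i → ψ (i , j)) (λ i → ≤-trans (x≤x+y _ (0≤H i j)) (≤-reflexive (ψ-H i j))) i≤i′)
      (monotone (λ j → ψ (i′ , j)) (λ j → ≤-trans (x≤x+y _ (0≤V i′ j)) (≤-reflexive (ψ-V i′ j))) j≤j′)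

-- Levels and walks in the grid.

module GridWalks (m n : ℕ) where
  open Grid m n
  open FiniteDigraph grid using (IsWalk; Path)

  level : GridVertex → ℕ
  level (i , j) = toℕ i ℕ.+ toℕ j

  level-tgt : ∀ e → level (gridTgt e) ≡ suc (level (gridSrc e))
  level-tgt (inj₁ (i , j)) = ≡.cong (λ k → suc (k ℕ.+ toℕ j)) (≡.sym (Fin.toℕ-inject₁ i))
  level-tgt (inj₂ (i , j)) = ≡.trans (ℕ.+-suc (toℕ i) (toℕ j))
    (≡.cong (λ k → suc (toℕ i ℕ.+ k)) (≡.sym (Fin.toℕ-inject₁ j)))

  walk-ascends : ∀ es {u w} → IsWalk u es w → All (λ v → level u ℕ.< level v) (map gridTgt es)
  walk-ascends []       _          = []
  walk-ascends (e ∷ es) (refl , p) = up ∷ All.map (ℕ.<-trans up) (walk-ascends es p)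
    where up = ℕ.≤-reflexive (≡.sym (level-tgt e))

  -- The level rises along every grid edge, so no vertex recurs. Walks spliced from pieces of paths
  -- are thus paths again.
  walk-simple : ∀ es {u w} → IsWalk u es w → Unique (u ∷ map gridTgt es)
  walk-simple []       _          = [] ∷ []
  walk-simple (e ∷ es) p@(refl , p′) =
    All.map (λ u<v u≡v → ℕ.<-irrefl (≡.cong level u≡v) u<v) (walk-ascends (e ∷ es) p)
      ∷ walk-simple es p′

  walk⇒path : ∀ es {u w} → IsWalk u es w → Path u w
  walk⇒path es p = record { pathEdges = es ; isWalk = p ; isSimple = walk-simple es p }

  walk-just : ∀ {u v} es {w z} → IsWalk w es z →
    FiniteDigraph.IsWalk (gridWithChord u v) w (map just es) z
  walk-just []       p          = p
  walk-just (e ∷ es) (refl , p) = refl , walk-just es p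

  path-just : ∀ {u v w z} → Path w z → FiniteDigraph.Path (gridWithChord u v) w z
  path-just {u} {v} {w} p = record
    { pathEdges = map just (Path.pathEdges p)
    ; isWalk    = walk-just (Path.pathEdges p) (Path.isWalk p)
    ; isSimple  = ≡.subst (λ vs → Unique (w ∷ vs)) (List.map-∘ (Path.pathEdges p)) (Path.isSimple p)
    }

-- The old equilibrium flow as a gradient.

module GridEquilibrium {c ℓ₁ ℓ₂} (ℝ : RealField c ℓ₁ ℓ₂) (m n : ℕ)
  (a b q : RealField.Carrier ℝ) (0<a : RealField._<_ ℝ (RealField.0# ℝ) a)
  (ue : Flows.UserEquilibrium ℝ (Braess.gridNetwork ℝ (suc m) (suc n) a b) q) where
  open RealField ℝ hiding (zero)
  open OrderedField ℝ
  open Braess ℝ (suc m) (suc n)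
  open Equilibrium ℝ (gridNetwork a b)
  open GridWalks (suc m) (suc n)
  open UserEquilibrium ue
  open IsFeasible isFeasible
  open FiniteDigraph grid using (Path)
  open Path
  open ≤-Reasoning

  H : Fin (suc m) → Fin (suc (suc n)) → Carrier
  H i j = flow (inj₁ (i , j))

  V : Fin (suc (suc m)) → Fin (suc n) → Carrier
  V i j = flow (inj₂ (i , j))

  private
    ℓ : GridEdge → Carrier
    ℓ e = a * flow e + b

    ∑-through : ∀ es {e} es′ → ∑ (es ++ e ∷ es′) ℓ ≈ ∑ es ℓ + (ℓ e + ∑ es′ ℓ)
    ∑-through es es′ = ∑-++ es _ ℓ

  -- Exchanging the tails of a used path through e₁ and a used path through e₂
  -- yields a shortest path through both.
  exchange : ∀ {e₁ e₂ e₃ e₄} → gridTgt e₁ ≡ gridSrc e₂ → gridSrc e₁ ≡ gridSrc e₃ →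
    gridTgt e₃ ≡ gridSrc e₄ → gridTgt e₂ ≡ gridTgt e₄ →
    0# < flow e₁ → 0# < flow e₂ → flow e₁ + flow e₂ ≤ flow e₃ + flow e₄
  exchange {e₁} {e₂} {e₃} {e₄} t₁≡s₂ s₁≡s₃ t₃≡s₄ t₂≡t₄ 0<f₁ 0<f₂
    with used-path ue e₁ 0<f₁ | used-path ue e₂ 0<f₂
  ... | p , e₁∈p , p-short | p′ , e₂∈p′ , p′-short
    with ∈-∃++ e₁∈p | ∈-∃++ e₂∈p′ | isWalk p | isWalk p′
  ... | as , bs , p≡ | as′ , bs′ , p′≡ | walk | walk′
    rewrite p≡ | p′≡
    with walk-split as walk | walk-split as′ walk′
  ... | as-walk , bs-walk | as′-walk , bs′-walk =
    *-cancelˡ-≤ 0<a (+-cancelʳ-≤ (b + b) (+-cancelʳ-≤ (A + A′ + (B + B′)) (begin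
      a * (f₁ + f₂) + (b + b) + (A + A′ + (B + B′))
        ≈⟨ rearrange₁ ⟩
      (A + ((a * f₁ + b) + B)) + (A′ + ((a * f₂ + b) + B′))
        ≤⟨ +-mono-≤ via₃₄ via-swap ⟩
      (A + ((a * f₃ + b) + ((a * f₄ + b) + B′))) + (A′ + B)
        ≈⟨ rearrange₂ ⟩
      a * (f₃ + f₄) + (b + b) + (A + A′ + (B + B′))
        ∎)))
    where
    f₁ = flow e₁
    f₂ = flow e₂
    f₃ = flow e₃
    f₄ = flow e₄
    A  = ∑ as ℓ
    A′ = ∑ as′ ℓ
    B  = ∑ bs ℓ
    B′ = ∑ bs′ ℓ
    -- `as′` ends at the common vertex of `e₁` and `e₂`, where `bs` begins. Added to `via₃₄`, this
    -- makes all four partial walks cancel, together with the constants `b + b`.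
    via-swap : A′ + ((a * f₂ + b) + B′) ≤ A′ + B
    via-swap = begin
      A′ + (ℓ e₂ + B′)          ≈⟨ ∑-through as′ bs′ ⟨
      ∑ (as′ ++ e₂ ∷ bs′) ℓ     ≤⟨ p′-short (walk⇒path (as′ ++ bs) (walk-++ as′ as′-walk
        (≡.subst (λ w → FiniteDigraph.IsWalk grid w bs _) t₁≡s₂ bs-walk))) ⟩
      ∑ (as′ ++ bs) ℓ           ≈⟨ ∑-++ as′ bs ℓ ⟩
      A′ + B                    ∎
    via₃₄ : A + ((a * f₁ + b) + B) ≤ A + ((a * f₃ + b) + ((a * f₄ + b) + B′))
    via₃₄ = begin
      A + (ℓ e₁ + B)                     ≈⟨ ∑-through as bs ⟨
      ∑ (as ++ e₁ ∷ bs) ℓ                ≤⟨ p-short (walk⇒path (as ++ e₃ ∷ e₄ ∷ bs′) (walk-++ as as-walk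
        (≡.sym s₁≡s₃ , ≡.sym t₃≡s₄ ,
          ≡.subst (λ w → FiniteDigraph.IsWalk grid w bs′ _) t₂≡t₄ bs′-walk))) ⟩
      ∑ (as ++ e₃ ∷ e₄ ∷ bs′) ℓ          ≈⟨ ∑-++ as _ ℓ ⟩
      A + (ℓ e₃ + (ℓ e₄ + B′))           ∎
    rearrange₁ : a * (f₁ + f₂) + (b + b) + (A + A′ + (B + B′)) ≈
      (A + ((a * f₁ + b) + B)) + (A′ + ((a * f₂ + b) + B′))
    rearrange₁ = solve 8 (λ a b f₁ f₂ A A′ B B′ →
      a :* (f₁ :+ f₂) :+ (b :+ b) :+ (A :+ A′ :+ (B :+ B′)) :=
      (A :+ ((a :* f₁ :+ b) :+ B)) :+ (A′ :+ ((a :* f₂ :+ b) :+ B′))) ≈-refl a b f₁ f₂ A A′ B B′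
    rearrange₂ : (A + ((a * f₃ + b) + ((a * f₄ + b) + B′))) + (A′ + B) ≈
      a * (f₃ + f₄) + (b + b) + (A + A′ + (B + B′))
    rearrange₂ = solve 8 (λ a b f₃ f₄ A A′ B B′ →
      (A :+ ((a :* f₃ :+ b) :+ ((a :* f₄ :+ b) :+ B′))) :+ (A′ :+ B) :=
      a :* (f₃ :+ f₄) :+ (b :+ b) :+ (A :+ A′ :+ (B :+ B′))) ≈-refl a b f₃ f₄ A A′ B B′

  private
    0≤H : ∀ i j → 0# ≤ H i j
    0≤H i j = nonneg (inj₁ (i , j))

    0≤V : ∀ i j → 0# ≤ V i j
    0≤V i j = nonneg (inj₂ (i , j))

    pair : ∀ {x y z} → x ≤ y + (z + 0#) → x ≤ y + z
    pair x≤ = ≤-trans x≤ (≤-reflexive (+-congˡ (+-identityʳ _)))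

    single : ∀ {x y} → x ≤ y + 0# → x ≤ y
    single x≤ = ≤-trans x≤ (≤-reflexive (+-identityʳ _))

    suc-i≢s : ∀ {i j} → _≢_ {A = GridVertex} (suc i , j) (zero , zero)
    suc-i≢s ()

    suc-j≢s : ∀ {i j} → _≢_ {A = GridVertex} (i , suc j) (zero , zero)
    suc-j≢s ()

    inject₁-i≢t : ∀ {i j} →
      _≢_ {A = GridVertex} (inject₁ i , j) (fromℕ (suc m) , fromℕ (suc n))
    inject₁-i≢t v≡t = Fin.fromℕ≢inject₁ (≡.sym (≡.cong proj₁ v≡t))

    inject₁-j≢t : ∀ {i j} →
      _≢_ {A = GridVertex} (i , inject₁ j) (fromℕ (suc m) , fromℕ (suc n))
    inject₁-j≢t v≡t = Fin.fromℕ≢inject₁ (≡.sym (≡.cong proj₂ v≡t))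

    in-suc-suc : ∀ {i j} e → gridTgt e ≡ (suc i , suc j) →
      e ∈ inj₂ (suc i , j) ∷ inj₁ (i , suc j) ∷ []
    in-suc-suc (inj₁ _) refl = there (here refl)
    in-suc-suc (inj₂ _) refl = here refl

    in-suc-zero : ∀ {i} e → gridTgt e ≡ (suc i , zero) → e ∈ inj₁ (i , zero) ∷ []
    in-suc-zero (inj₁ _) refl = here refl
    in-suc-zero (inj₂ _) ()

    in-zero-suc : ∀ {j} e → gridTgt e ≡ (zero , suc j) → e ∈ inj₂ (zero , j) ∷ []
    in-zero-suc (inj₁ _) ()
    in-zero-suc (inj₂ _) refl = here refl

    out-inject₁-inject₁ : ∀ {i j} e → gridSrc e ≡ (inject₁ i , inject₁ j) →
      e ∈ inj₂ (inject₁ i , j) ∷ inj₁ (i , inject₁ j) ∷ []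
    out-inject₁-inject₁ (inj₁ _) s≡
      with refl ← Fin.inject₁-injective (≡.cong proj₁ s≡) | refl ← ≡.cong proj₂ s≡ = there (here refl)
    out-inject₁-inject₁ (inj₂ _) s≡
      with refl ← ≡.cong proj₁ s≡ | refl ← Fin.inject₁-injective (≡.cong proj₂ s≡) = here refl

    out-fromℕ-inject₁ : ∀ {j} e → gridSrc e ≡ (fromℕ (suc m) , inject₁ j) →
      e ∈ inj₂ (fromℕ (suc m) , j) ∷ []
    out-fromℕ-inject₁ (inj₁ _) s≡ = ⊥-elim (Fin.fromℕ≢inject₁ (≡.sym (≡.cong proj₁ s≡)))
    out-fromℕ-inject₁ (inj₂ _) s≡
      with refl ← ≡.cong proj₁ s≡ | refl ← Fin.inject₁-injective (≡.cong proj₂ s≡) = here refl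

    out-inject₁-fromℕ : ∀ {i} e → gridSrc e ≡ (inject₁ i , fromℕ (suc n)) →
      e ∈ inj₁ (i , fromℕ (suc n)) ∷ []
    out-inject₁-fromℕ (inj₁ _) s≡
      with refl ← Fin.inject₁-injective (≡.cong proj₁ s≡) | refl ← ≡.cong proj₂ s≡ = here refl
    out-inject₁-fromℕ (inj₂ _) s≡ = ⊥-elim (Fin.fromℕ≢inject₁ (≡.sym (≡.cong proj₂ s≡)))

    -- The second coordinate of the balanced vertex is `inject₁ (suc j)`, which is definitionally
    -- `suc (inject₁ j)`: the first form rules out the sink, the second identifies the incoming
    -- edges. The next three estimates use the same coincidence.
    V-in : ∀ i j → V (suc i) (suc j) ≤ V (suc i) (inject₁ j) + H i (suc (inject₁ j))
    V-in i j = pair (inflow≈outflow⇒≤ ue suc-i≢s inject₁-j≢t _ in-suc-suc refl)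

    H-in : ∀ i j → H (suc i) (suc j) ≤ V (suc (inject₁ i)) j + H (inject₁ i) (suc j)
    H-in i j = pair (inflow≈outflow⇒≤ ue suc-i≢s inject₁-i≢t _ in-suc-suc refl)

    V-out : ∀ i j → V (inject₁ i) (inject₁ j) ≤ V (inject₁ i) (suc j) + H i (suc (inject₁ j))
    V-out i j = pair (outflow≈inflow⇒≤ ue suc-j≢s inject₁-i≢t _ out-inject₁-inject₁ refl)

    H-out : ∀ i j → H (inject₁ i) (inject₁ j) ≤ V (suc (inject₁ i)) j + H (suc i) (inject₁ j)
    H-out i j = pair (outflow≈inflow⇒≤ ue suc-i≢s inject₁-j≢t _ out-inject₁-inject₁ refl)

    swap : ∀ {x y z} → x ≤ y + z → x ≤ z + y
    swap x≤ = ≤-trans x≤ (≤-reflexive (+-comm _ _))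

  -- Transposing the grid interchanges `H` with `V` and the two sides of each square, so `square-≤`
  -- for the transposed flow is the reverse inequality.
  square : ∀ i j → H i (inject₁ j) + V (suc i) j ≈ V (inject₁ i) j + H i (suc j)
  square i j = antisym
    (GridFlow.square-≤ ℝ H V 0≤H 0≤V
      (λ i j → exchange refl refl refl refl)
      (λ i → single (inflow≈outflow⇒≤ ue suc-i≢s inject₁-j≢t _ in-suc-zero refl))
      (λ j → single (outflow≈inflow⇒≤ ue suc-i≢s inject₁-j≢t _ out-fromℕ-inject₁ refl))
      (λ i j → swap (V-in i j)) (λ i j → swap (V-out i j)) H-in H-out i j)
    (GridFlow.square-≤ ℝ (λ j i → V i j) (λ j i → H i j) (λ j i → 0≤V i j) (λ j i → 0≤H i j)
      (λ j i → exchange refl refl refl refl)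
      (λ j → single (inflow≈outflow⇒≤ ue suc-j≢s inject₁-i≢t _ in-zero-suc refl))
      (λ i → single (outflow≈inflow⇒≤ ue suc-j≢s inject₁-i≢t _ out-inject₁-fromℕ refl))
      (λ j i → H-in i j) (λ j i → H-out i j) (λ j i → swap (V-in i j)) (λ j i → swap (V-out i j)) j i)

  open GridFlow.Potential ℝ H V square public using (ψ)

  ψ-tgt : ∀ e → ψ (gridSrc e) + flow e ≈ ψ (gridTgt e)
  ψ-tgt (inj₁ (i , j)) = GridFlow.Potential.ψ-H ℝ H V square i j
  ψ-tgt (inj₂ (i , j)) = GridFlow.Potential.ψ-V ℝ H V square i j

  ψ-mono : ∀ {i i′ j j′} → i Fin.≤ i′ → j Fin.≤ j′ → ψ (i , j) ≤ ψ (i′ , j′)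
  ψ-mono = GridFlow.Potential.ψ-mono ℝ H V square 0≤H 0≤V

  ψ-source : ψ (zero , zero) ≈ 0#
  ψ-source = +-identityʳ 0#

-- Comparison of the old and the new equilibrium.

module Chord {c ℓ₁ ℓ₂} (ℝ : RealField c ℓ₁ ℓ₂) (m n : ℕ) where
  open RealField ℝ hiding (zero)
  open OrderedField ℝ
  open Bounds ℝ
  open Braess ℝ (suc m) (suc n)
  open GridWalks (suc m) (suc n)
  open ≤-Reasoning

  module _ (q a b c d : Carrier)
    (0<q : 0# < q) (0<a : 0# < a) (0≤b : 0# ≤ b) (0≤c : 0# ≤ c) (0≤d : 0# ≤ d)
    (u v : GridVertex)
    (old : UserEquilibrium (gridNetwork a b) q)
    (new : UserEquilibrium (chordNetwork a b c d u v) q) where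

    open GridEquilibrium ℝ m n a b q 0<a old using (ψ; ψ-tgt; ψ-mono; ψ-source)

    private
      module Old = Equilibrium ℝ (gridNetwork a b)
      module New = Equilibrium ℝ (chordNetwork a b c d u v)
      newNonneg = Flows.IsFeasible.nonneg (UserEquilibrium.isFeasible new)

      s≢t : _≢_ {A = GridVertex} (zero , zero) (fromℕ (suc m) , fromℕ (suc n))
      s≢t ()

    f g : GridEdge → Carrier
    f = UserEquilibrium.flow old
    g = UserEquilibrium.flow new ∘ just

    x : Carrier
    x = UserEquilibrium.flow new nothing

    E S G M Cold Cnew : Carrier
    E = ∑ gridEdges (λ e → f e * f e)
    S = ∑ gridEdges (λ e → f e * g e)
    G = ∑ gridEdges (λ e → g e * g e)
    M = fromNat (suc m ℕ.+ suc n)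
    Cold = cost (gridNetwork a b) f
    Cnew = cost (chordNetwork a b c d u v) (UserEquilibrium.flow new)

    private
      ∑-new : ∀ h → ∑ (nothing ∷ map just gridEdges) h ≈ h nothing + ∑ gridEdges (h ∘ just)
      ∑-new h = +-congˡ (∑-map just gridEdges h)

      φ : GridVertex → Carrier
      φ = fromNat ∘ level

      φ-tgt : ∀ e → φ (gridSrc e) + 1# ≈ φ (gridTgt e)
      φ-tgt e rewrite level-tgt e = +-comm _ 1#

      φt≡M : φ (fromℕ (suc m) , fromℕ (suc n)) ≡ M
      φt≡M = ≡.cong₂ (λ i j → fromNat (i ℕ.+ j)) (Fin.toℕ-fromℕ (suc m)) (Fin.toℕ-fromℕ (suc n))

      ∑f≈qM : ∑ gridEdges (λ e → f e * 1#) ≈ q * M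
      ∑f≈qM = ≡.subst (λ z → ∑ gridEdges (λ e → f e * 1#) ≈ q * z) φt≡M
        (Old.∑-flow-potential old s≢t φ (λ _ → 1#) φ-tgt ≈-refl)

      -- A grid potential stays a potential in the new network once the chord is given the
      -- difference of its end values, whatever its sign.
      new-potential : ∀ (φ : GridVertex → Carrier) (h : GridEdge → Carrier) →
        (∀ e → φ (gridSrc e) + h e ≈ φ (gridTgt e)) → φ (zero , zero) ≈ 0# →
        x * (φ v - φ u) + ∑ gridEdges (λ e → g e * h e) ≈ q * φ (fromℕ (suc m) , fromℕ (suc n))
      new-potential φ h φ+h φs≈0 = begin-equality
        x * (φ v - φ u) + ∑ gridEdges (λ e → g e * h e)
          ≈⟨ ∑-new (λ e → UserEquilibrium.flow new e * h′ e) ⟨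
        ∑ (nothing ∷ map just gridEdges) (λ e → UserEquilibrium.flow new e * h′ e)
          ≈⟨ New.∑-flow-potential new s≢t φ h′ φ+h′ φs≈0 ⟩
        q * φ (fromℕ (suc m) , fromℕ (suc n)) ∎
        where
        h′ : Maybe GridEdge → Carrier
        h′ nothing  = φ v - φ u
        h′ (just e) = h e
        φ+h′ : ∀ e → φ (FiniteDigraph.src (gridWithChord u v) e) + h′ e ≈
                     φ (FiniteDigraph.tgt (gridWithChord u v) e)
        φ+h′ nothing  = x+[y-x]≈y (φ u) (φ v)
        φ+h′ (just e) = φ+h e

      xκ+∑g≈qM : x * (φ v - φ u) + ∑ gridEdges (λ e → g e * 1#) ≈ q * M
      xκ+∑g≈qM = ≡.subst (λ z → x * (φ v - φ u) + ∑ gridEdges (λ e → g e * 1#) ≈ q * z) φt≡M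
        (new-potential φ (λ _ → 1#) φ-tgt ≈-refl)

    Cold≈ : Cold ≈ a * E + b * (q * M)
    Cold≈ = ≈-trans (∑-affine gridEdges f f a b) (+-congˡ (*-congˡ ∑f≈qM))

    -- The edge flows add up to qM > 0, so some edge carries positive flow, and its square already
    -- makes `a * E` positive.
    Cold-positive : 0# < Cold
    Cold-positive
      with ∑-pos⇒∃pos gridEdges (λ e → f e * 1#)
             (<-≤-trans (*-pos 0<q (fromNat-pos (suc m ℕ.+ suc n) (ℕ.s≤s ℕ.z≤n)))
               (≤-reflexive (≈-sym ∑f≈qM)))
    ... | e , e∈ , 0<fe*1 = begin-strict
      0#                  <⟨ *-pos 0<a (*-pos 0<fe 0<fe) ⟩
      a * (f e * f e)     ≤⟨ *-monoˡ-≤ (<⇒≤ 0<a) (∈⇒≤∑ gridEdges (λ e → square-nonneg (f e)) e∈) ⟩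
      a * E               ≤⟨ x≤x+y _ (*-nonneg 0≤b
                              (*-nonneg (<⇒≤ 0<q) (fromNat-nonneg (suc m ℕ.+ suc n)))) ⟩
      a * E + b * (q * M) ≈⟨ Cold≈ ⟨
      Cold                ∎
      where
      0<fe : 0# < f e
      0<fe = <-≤-trans 0<fe*1 (≤-reflexive (*-identityʳ (f e)))

    -- The old paths are available in the new network.
    Cnew≤ : Cnew ≤ a * S + b * (q * M)
    Cnew≤ = begin
      Cnew                                              ≤⟨ proj₁ (proj₂ latency) ⟩
      q * Λ                                             ≈⟨ *-congʳ (Old.∑-amounts old s≢t) ⟨
      ∑ pathFlows proj₂ * Λ                             ≈⟨ ∑-*ʳ pathFlows Λ proj₂ ⟨
      ∑ pathFlows (λ py → proj₂ py * Λ)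
        ≤⟨ ∑-mono pathFlows (λ {py} py∈ → *-monoˡ-≤ (amount-nonneg py∈) (Λ≤-old (proj₁ py))) ⟩
      ∑ pathFlows (λ py → proj₂ py * ∑ (FiniteDigraph.Path.pathEdges (proj₁ py)) ℓ)
                                                        ≈⟨ Old.∑-flow-* old ℓ ⟨
      ∑ gridEdges (λ e → f e * ℓ e)                     ≈⟨ ∑-affine gridEdges f g a b ⟩
      a * S + b * ∑ gridEdges (λ e → f e * 1#)          ≈⟨ +-congˡ (*-congˡ ∑f≈qM) ⟩
      a * S + b * (q * M)                               ∎
      where
      open UserEquilibrium old using (pathFlows; amount-nonneg)
      latency = New.equilibrium-latency new s≢t 0<q
      Λ = proj₁ latency
      ℓ : GridEdge → Carrier
      ℓ e = a * g e + b
      Λ≤-old : ∀ p → Λ ≤ ∑ (FiniteDigraph.Path.pathEdges p) ℓ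
      Λ≤-old p = ≤-trans (proj₂ (proj₂ latency) (path-just p))
        (≤-reflexive (∑-map just (FiniteDigraph.Path.pathEdges p) _))

    -- The chord's own cost is nonnegative and is dropped from `Cnew`. The unknown total `Σg` then
    -- cancels, because the level potential expresses `q * M` through it and the chord flow.
    aG≤ : ∀ k → φ v ≤ φ u + k → 0# ≤ k → a * G ≤ a * S + b * (q * k)
    aG≤ k φv≤ 0≤k = +-cancelʳ-≤ (b * Σg) (begin
      a * G + b * Σg
        ≤⟨ x≤x+y _ (*-nonneg (newNonneg nothing) (+-nonneg (*-nonneg 0≤c (newNonneg nothing)) 0≤d)) ⟩
      a * G + b * Σg + x * (c * x + d)
        ≈⟨ +-comm _ _ ⟩
      x * (c * x + d) + (a * G + b * Σg)
        ≈⟨ +-congˡ (∑-affine gridEdges g g a b) ⟨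
      x * (c * x + d) + ∑ gridEdges (λ e → g e * (a * g e + b))
        ≈⟨ ∑-new (λ e → UserEquilibrium.flow new e
             * Network.latency (chordNetwork a b c d u v) e (UserEquilibrium.flow new e)) ⟨
      Cnew
        ≤⟨ Cnew≤ ⟩
      a * S + b * (q * M)
        ≈⟨ +-congˡ (*-congˡ xκ+∑g≈qM) ⟨
      a * S + b * (x * (φ v - φ u) + Σg)
        -- The level difference may be negative, so it is first raised to `k`, using 0 ≤ x; only
        -- then is `x` raised to `q`, using 0 ≤ k.
        ≤⟨ +-monoʳ-≤ _ (*-monoˡ-≤ 0≤b (+-monoˡ-≤ Σg (≤-trans
             (*-monoˡ-≤ (newNonneg nothing) κ≤k)
             (*-monoʳ-≤ 0≤k (New.flow≤demand new s≢t nothing))))) ⟩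
      a * S + b * (q * k + Σg)
        ≈⟨ solve 4 (λ y b z w → y :+ b :* (z :+ w) := y :+ b :* z :+ b :* w) ≈-refl
             (a * S) b (q * k) Σg ⟩
      a * S + b * (q * k) + b * Σg
        ∎)
      where
      Σg = ∑ gridEdges (λ e → g e * 1#)
      κ≤k : φ v - φ u ≤ k
      κ≤k = begin
        φ v - φ u         ≤⟨ +-monoˡ-≤ (- φ u) φv≤ ⟩
        φ u + k - φ u     ≈⟨ +-congʳ (+-comm (φ u) k) ⟩
        k + φ u - φ u     ≈⟨ x+y-y≈x k (φ u) ⟩
        k                 ∎

    -- All directed grid paths have the same latency in the old equilibrium, so a
    -- chord along such a path only shortens the paths of the new flow.
    forward⇒S≤E : proj₁ u Fin.≤ proj₁ v → proj₂ u Fin.≤ proj₂ v → S ≤ E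
    forward⇒S≤E u₁≤v₁ u₂≤v₂ = begin
      S
        ≈⟨ ∑-cong gridEdges (λ e → *-comm (f e) (g e)) ⟩
      ∑ gridEdges (λ e → g e * f e)
        ≤⟨ x≤x+y _ (*-nonneg (newNonneg nothing) (0≤y-x (ψ-mono u₁≤v₁ u₂≤v₂))) ⟩
      ∑ gridEdges (λ e → g e * f e) + x * (ψ v - ψ u)
        ≈⟨ +-comm _ _ ⟩
      x * (ψ v - ψ u) + ∑ gridEdges (λ e → g e * f e)
        ≈⟨ new-potential ψ f ψ-tgt ψ-source ⟩
      q * ψ (fromℕ (suc m) , fromℕ (suc n))
        ≈⟨ Old.∑-flow-potential old s≢t ψ f ψ-tgt ψ-source ⟨
      E ∎

    module _ (1≤m : 1 ℕ.≤ suc m) (1<m⊔n : 1 ℕ.< suc m ⊔ suc n) {r : Carrier}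
      (r-isSqrt : IsSqrt (ρ 1≤m 1<m⊔n) r) where

      private
        -- This is the K of the overview, not the level difference of the chord; `k` is its image in
        -- the field.
        κ : ℕ
        κ = suc m ⊔ suc n ∸ 1

        k : Carrier
        k = fromNat κ

        p : Carrier
        p = ρ 1≤m 1<m⊔n + 2 · r

        0≤r = proj₁ r-isSqrt
        rr≈ρ = proj₂ r-isSqrt

        0<k : 0# < k
        0<k = fromNat-pos κ (ℕ.m<n⇒0<n∸m 1<m⊔n)

        0<p : 0# < p
        0<p = +-pos-nonneg (ρ-pos 1≤m 1<m⊔n) (·-nonneg 2 0≤r)

        rrk≈M : r * r * k ≈ M
        rrk≈M = ≈-trans (*-congʳ rr≈ρ) ([x/y]*y≈x M _)

        κ<m+n : κ ℕ.< suc m ℕ.+ suc n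
        -- `suc κ` is definitionally the maximum `suc m ⊔ suc n`.
        κ<m+n = ℕ.m⊔n≤m+n (suc m) (suc n)

        1<ρ : 1# < ρ 1≤m 1<m⊔n
        1<ρ = </- _ (begin-strict
          k * 1#   ≈⟨ *-identityʳ k ⟩
          k        <⟨ fromNat-mono-< κ<m+n ⟩
          M        ∎)

        -- Here `m` stands for K and `n` for the side of the grid in the other direction. The level
        -- gain is at least `suc m`, hence at least `n`, and the other coordinate supplies at most
        -- `n` of it, so this one cannot drop.
        forward : ∀ {i i′ j j′ m n} → j′ ℕ.≤ n → n ℕ.≤ suc m → i ℕ.+ j ℕ.+ m ℕ.< i′ ℕ.+ j′ → i ℕ.≤ i′
        forward {i} {i′} {j} {j′} {m} {n} j′≤n n≤1+m i+j+m<i′+j′ = ℕ.+-cancelʳ-≤ n i i′ (ℕ.≤-trans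
          (ℕ.≤-trans (ℕ.+-monoʳ-≤ i n≤1+m) (ℕ.≤-trans (ℕ.≤-reflexive (ℕ.+-suc i m))
            (ℕ.≤-trans (ℕ.s≤s (ℕ.+-monoˡ-≤ m (ℕ.m≤m+n i j))) i+j+m<i′+j′)))
          (ℕ.+-monoʳ-≤ i′ j′≤n))

        within : level v ℕ.≤ level u ℕ.+ κ → Cnew * p ≤ Cold * (p + 1#)
        within lv≤lu+κ = begin
          Cnew * p
            ≤⟨ *-monoʳ-≤ (<⇒≤ 0<p) Cnew≤ ⟩
          (a * S + b * (q * M)) * p
            ≈⟨ *-cong (+-congˡ β≈) p≈ ⟨
          (a * S + b * (q * (r * r * k))) * (r * r + 2 · r)
            ≤⟨ optimised-bound (<⇒≤ 0<a) 0≤r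
                 (aG≤ k (≤-trans (fromNat-mono-≤ lv≤lu+κ) (≤-reflexive (fromNat-+ (level u) κ)))
                   (<⇒≤ 0<k))
                 (∑-2xy≤x²+y² gridEdges f g (1# + r) r) ⟩
          (a * E + b * (q * (r * r * k))) * (r * r + 2 · r + 1#)
            ≈⟨ *-cong (+-congˡ β≈) (+-congʳ p≈) ⟩
          (a * E + b * (q * M)) * (p + 1#)
            ≈⟨ *-congʳ Cold≈ ⟨
          Cold * (p + 1#)
            ∎
          where
          β≈ : b * (q * (r * r * k)) ≈ b * (q * M)
          β≈ = *-congˡ (*-congˡ rrk≈M)
          p≈ : r * r + 2 · r ≈ p
          p≈ = +-congʳ rr≈ρ

        beyond : level u ℕ.+ κ ℕ.< level v → Cnew * p ≤ Cold * (p + 1#)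
        beyond lu+κ<lv = trivial-bound (<⇒≤ 0<p) (<⇒≤ Cold-positive) (begin
          Cnew                   ≤⟨ Cnew≤ ⟩
          a * S + b * (q * M)    ≤⟨ +-monoˡ-≤ _ (*-monoˡ-≤ (<⇒≤ 0<a) (forward⇒S≤E u₁≤v₁ u₂≤v₂)) ⟩
          a * E + b * (q * M)    ≈⟨ Cold≈ ⟨
          Cold                   ∎)
          where
          u₁≤v₁ : proj₁ u Fin.≤ proj₁ v
          u₁≤v₁ = forward (ℕ.≤-pred (Fin.toℕ<n (proj₂ v))) (ℕ.m≤n⊔m (suc m) (suc n)) lu+κ<lv
          u₂≤v₂ : proj₂ u Fin.≤ proj₂ v
          u₂≤v₂ = forward (ℕ.≤-pred (Fin.toℕ<n (proj₁ v))) (ℕ.m≤m⊔n (suc m) (suc n))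
            (≡.subst₂ (λ y z → y ℕ.+ κ ℕ.< z) (ℕ.+-comm (toℕ (proj₁ u)) (toℕ (proj₂ u)))
              (ℕ.+-comm (toℕ (proj₁ v)) (toℕ (proj₂ v))) lu+κ<lv)

        Cnew*p≤ : Cnew * p ≤ Cold * (p + 1#)
        Cnew*p≤ = [ within , beyond ]′ (ℕ.≤-<-connex (level v) (level u ℕ.+ κ))

      braess-ratio : Σ[ Cold-pos ∈ 0# < Cold ]
        (Cnew / Cold [ Cold-pos ] ≤ bound 1≤m 1<m⊔n r-isSqrt × bound 1≤m 1<m⊔n r-isSqrt < 4/3)
      braess-ratio = Cold-positive
        , /-≤1+1/ Cold-positive 0<p Cnew*p≤
        , 1+1/<4/3 0<p (3<ρ+2√ρ 0≤r rr≈ρ 1<ρ)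

theorem4p1 : ∀ {ℓ ℓ₁ ℓ₂} (ℝ : RealField ℓ ℓ₁ ℓ₂) (m n : ℕ) →
  let open RealField ℝ
      open Braess ℝ m n
  in
  (1≤m : 1 ℕ.≤ m) → 1 ℕ.≤ n → (1<m⊔n : 1 ℕ.< m ⊔ n) →
  (q a b c d : Carrier) → 0# < q → 0# < a → 0# ≤ b → 0# ≤ c → 0# ≤ d →
  (u v : GridVertex) → IsChord u v →
  let oldNetwork = gridNetwork a b
      newNetwork = chordNetwork a b c d u v
  in
  (old : UserEquilibrium oldNetwork q) (new : UserEquilibrium newNetwork q) →
  let Cold = cost oldNetwork (UserEquilibrium.flow old)
      Cnew = cost newNetwork (UserEquilibrium.flow new)
  in
  ∀ {√ρ} (√ρ-isSqrt : IsSqrt (ρ 1≤m 1<m⊔n) √ρ) →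
  Σ[ Cold-pos ∈ 0# < Cold ]
    (Cnew / Cold [ Cold-pos ] ≤ bound 1≤m 1<m⊔n √ρ-isSqrt
     × bound 1≤m 1<m⊔n √ρ-isSqrt < 4/3)
theorem4p1 ℝ (suc m) (suc n) 1≤m (ℕ.s≤s _) 1<m⊔n q a b c d 0<q 0<a 0≤b 0≤c 0≤d u v _ old new =
  Chord.braess-ratio ℝ m n q a b c d 0<q 0<a 0≤b 0≤c 0≤d u v old new 1≤m 1<m⊔n
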